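{- Let $\mathscr{P}$ be a primitive orthoplicial Apollonian packing and let $\mathscr{B}=\mathscr{B}(\mathscr{P})$ be its set of bends. Then there is always a local obstruction modulo 4: there exists $\varepsilon=\varepsilon(\mathscr{P})\in\{\pm1\}$ such that, for every $b\in\mathscr{B}$, $$b\not\equiv-\varepsilon\pmod 4 .$$ Moreover, for any orthoplicial Platonic configuration $\mathscr{V}$ in $\mathscr{P}$, the ordered set of bends $b_k=b(S_k)$ of the constituent spheres of $\mathscr{V}$ satisfies $$(b_1,b_2,b_3,b_4,b_5,b_6,b_7,b_8)\equiv(0,0,\varepsilon,\varepsilon,2,2,\varepsilon,\varepsilon)\pmod 4$$ up to reordering by the permuting action of the orthoplicial Platonic group (that is, after passing to a suitable admissible ordering of $\mathscr{V}$).
   Context: Work in $\hat{\mathbb{R}}^3=\mathbb{R}^3\cup\{\infty\}$. A "sphere" $S$ means a Euclidean sphere, or a plane (with $\infty$ added), together with a choice of orienting region $B$, one of the two components of its complement. Its bend $b(S)$ is $1/r$ if $S$ is a Euclidean sphere of radius $r$ and $B$ is the ball, $-1/r$ if $B$ is the exterior of the ball, and $0$ if $S$ is a plane. Möbius transformations of $\hat{\mathbb{R}}^3$ (all conformal and anti-conformal transformations) act on oriented spheres by mapping $(S,B)$ to its image. The standard configuration $\mathscr{V}_0=(S_1,\dots,S_8)$ consists of: the plane $S_1=\{z=1\}$ oriented by $\{z>1\}$; the plane $S_2=\{z=-1\}$ oriented by $\{z<-1\}$; the unit spheres $S_3,S_4,S_7,S_8$ with centers $(\sqrt2,0,0),(0,\sqrt2,0),(-\sqrt2,0,0),(0,-\sqrt2,0)$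 respectively; and the spheres $S_5,S_6$ of radius $1/2$ with centers $(0,0,-\tfrac12),(0,0,\tfrac12)$ respectively; $S_3,\dots,S_8$ are oriented by the balls they bound. An orthoplicial Platonic configuration is the image of $\mathscr{V}_0$ under a Möbius transformation. An ordering $S_1,\dots,S_8$ of its spheres is admissible if distinct $S_i,S_j$ are tangent when $i\not\equiv j \pmod 4$ and disjoint when $i\equiv j\pmod 4$. The orthoplicial Platonic group is the full symmetry group (of order 384) of the 4-orthoplex; it permutes the eight spheres preserving tangency and acts simply transitively on the 384 admissible orderings. Each configuration $\mathscr{V}$ contains 16 quadruples $\mathscr{F}$ of pairwise tangent spheres; each has a unique dual sphere $S(\mathscr{F})$ orthogonal to its four members, and inverting $\mathscr{V}$ in $S(\mathscr{F})$ gives another orthoplicial configuration. An orthoplicial Apollonian packing $\mathscr{P}$ is the set of all spheres appearing in the family of configurations obtained from one configuration by successively applying all these inversions (to each configuration so obtained); the members of this family are the configurations "in $\mathscr{P}$". Let $\mathscr{B}(\mathscr{P})=\{b(S): S\in\mathscr{P}\}$. $\mathscr{P}$ is integral if $\mathscr{B}(\mathscr{P})\subset\mathbb{Z}$, and primitive if it is integral and $\gcd\mathscr{B}(\mathscr{P})=1$. -}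

module Defs where

open import Algebra.Bundles using (CommutativeRing)
import Algebra.Properties.Monoid.Mult as MonoidMult
import Algebra.Properties.Ring as RingProperties
open import Data.Empty using (⊥; ⊥-elim)
open import Data.Fin.Base using (Fin; toℕ)
open import Data.Integer.Base as ℤ using (ℤ; +_; -[1+_])
import Data.Integer.Divisibility as ℤ
open import Data.Nat.Base using (suc)
open import Data.Nat.DivMod using (_%_)
open import Data.Product using (∃; _×_; _,_; proj₁; proj₂)
open import Data.Sum.Base using (_⊎_)
open import Data.Unit.Base using (⊤)
open import Data.Vec.Base using ([]; _∷_; lookup)
open import Function.Base using (id; _∘_)
open import Function.Definitions using (Injective)
open import Level using (0ℓ)
open import Relation.Binary.Core using (Rel)
open import Relation.Binary.Definitions using (tri<; tri≈; tri>)
open import Relation.Binary.PropositionalEquality.Core using (_≡_; _≢_)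
open import Relation.Binary.Structures using (IsStrictTotalOrder)
open import Relation.Nullary.Decidable.Core using (yes; no)
open import Relation.Nullary.Negation.Core using (¬_)
open import Relation.Unary using (Pred; _∈_; _∩_; _≐_; Empty; Satisfiable)

infix 4 _≡_[mod_]

_≡_[mod_] : ℤ → ℤ → ℤ → Set
a ≡ b [mod m ] = m ℤ.∣ (a ℤ.- b)

record IsGCD (A : Pred ℤ 0ℓ) (g : ℤ) : Set where
  field
    commonDivisor : ∀ n → n ∈ A → g ℤ.∣ n
    greatest      : ∀ d → (∀ n → n ∈ A → d ℤ.∣ n) → d ℤ.∣ g

-- The standard library has no real numbers.  ℝ is given by its axioms: an
-- ordered field in which every nonempty set bounded above has a least upper
-- bound.  Classically such a field is unique up to isomorphism.  The order is
-- decidable and suprema exist for arbitrary predicates, as in classical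
-- mathematics.
record CompleteOrderedField : Set₁ where
  field
    commutativeRing : CommutativeRing 0ℓ 0ℓ

  open CommutativeRing commutativeRing public

  infix 4 _<_ _≤_

  field
    _<_                : Rel Carrier 0ℓ
    isStrictTotalOrder : IsStrictTotalOrder _≈_ _<_
    0<1                : 0# < 1#
    +-monoʳ-<          : ∀ x {y z} → y < z → x + y < x + z
    *-pos              : ∀ {x y} → 0# < x → 0# < y → 0# < x * y
    inverse            : ∀ x → ¬ (x ≈ 0#) → ∃ λ y → x * y ≈ 1#

  _≤_ : Rel Carrier 0ℓ
  x ≤ y = x < y ⊎ x ≈ y

  UpperBound : Pred Carrier 0ℓ → Pred Carrier 0ℓ
  UpperBound A u = ∀ x → x ∈ A → x ≤ u

  field
    supremum : (A : Pred Carrier 0ℓ) → Satisfiable A → Satisfiable (UpperBound A) →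
               ∃ λ s → s ∈ UpperBound A × (∀ u → u ∈ UpperBound A → s ≤ u)

module Geometry (ℛ : CompleteOrderedField) where

  open CompleteOrderedField ℛ renaming (Carrier to ℝ)
  open IsStrictTotalOrder isStrictTotalOrder
    using (compare; _≟_; <-respˡ-≈; <-respʳ-≈)
    renaming (irrefl to <-irrefl; trans to <-trans)
  open MonoidMult +-monoid using () renaming (_×_ to _times_)
  open RingProperties ring using (-‿distribʳ-*)

  fromℤ : ℤ → ℝ
  fromℤ (+ n)    = n times 1#
  fromℤ -[1+ n ] = - (suc n times 1#)

  pos⇒≉0 : ∀ {x} → 0# < x → ¬ (x ≈ 0#)
  pos⇒≉0 0<x x≈0 = <-irrefl (sym x≈0) 0<x

  inverse-pos : ∀ {x y} → 0# < x → x * y ≈ 1# → 0# < y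
  inverse-pos {x} {y} 0<x xy≈1 with compare 0# y
  ... | tri< 0<y _ _ = 0<y
  ... | tri≈ _ 0≈y _ = ⊥-elim (<-irrefl 0≈1 0<1)
    where
    0≈1 : 0# ≈ 1#
    0≈1 = trans (sym (zeroʳ x)) (trans (*-congˡ 0≈y) xy≈1)
  ... | tri> _ _ y<0 = ⊥-elim (<-irrefl refl (<-trans 0<1 1<0))
    where
    0<-y : 0# < - y
    0<-y = <-respˡ-≈ (-‿inverseˡ y) (<-respʳ-≈ (+-identityʳ (- y)) (+-monoʳ-< (- y) y<0))
    0<-1 : 0# < - 1#
    0<-1 = <-respʳ-≈ (trans (sym (-‿distribʳ-* x y)) (-‿cong xy≈1)) (*-pos 0<x 0<-y)
    1<0 : 1# < 0#
    1<0 = <-respˡ-≈ (+-identityʳ 1#) (<-respʳ-≈ (-‿inverseʳ 1#) (+-monoʳ-< 1# 0<-1))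

  2# : ℝ
  2# = 1# + 1#

  0<2 : 0# < 2#
  0<2 = <-trans 0<1 (<-respˡ-≈ (+-identityʳ 1#) (+-monoʳ-< 1# 0<1))

  ½ : ℝ
  ½ = proj₁ (inverse 2# (pos⇒≉0 0<2))

  0<½ : 0# < ½
  0<½ = inverse-pos 0<2 (proj₂ (inverse 2# (pos⇒≉0 0<2)))

  record ℝ³ : Set where
    constructor ⟨_,_,_⟩
    field
      x y z : ℝ

  infixl 6 _⊕_ _⊖_
  infixr 7 _⊛_
  infix  7 _·_

  _⊕_ _⊖_ : ℝ³ → ℝ³ → ℝ³
  ⟨ a , b , c ⟩ ⊕ ⟨ a′ , b′ , c′ ⟩ = ⟨ a + a′ , b + b′ , c + c′ ⟩
  ⟨ a , b , c ⟩ ⊖ ⟨ a′ , b′ , c′ ⟩ = ⟨ a - a′ , b - b′ , c - c′ ⟩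

  _⊛_ : ℝ → ℝ³ → ℝ³
  t ⊛ ⟨ a , b , c ⟩ = ⟨ t * a , t * b , t * c ⟩

  _·_ : ℝ³ → ℝ³ → ℝ
  ⟨ a , b , c ⟩ · ⟨ a′ , b′ , c′ ⟩ = a * a′ + b * b′ + c * c′

  ‖_‖² : ℝ³ → ℝ
  ‖ v ‖² = v · v

  data ℝ̂³ : Set where
    fin : ℝ³ → ℝ̂³
    ∞   : ℝ̂³

  infix 4 _≋_

  _≋_ : Rel ℝ̂³ 0ℓ
  fin ⟨ a , b , c ⟩ ≋ fin ⟨ a′ , b′ , c′ ⟩ = a ≈ a′ × b ≈ b′ × c ≈ c′
  fin _             ≋ ∞                    = ⊥
  ∞                 ≋ fin _                = ⊥
  ∞                 ≋ ∞                    = ⊤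

  image : (ℝ̂³ → ℝ̂³) → Pred ℝ̂³ 0ℓ → Pred ℝ̂³ 0ℓ
  image φ A q = ∃ λ p → p ∈ A × φ p ≋ q

  data Sphere : Set where
    round : (c : ℝ³) (r : ℝ) → 0# < r → Sphere           -- ‖ v ⊖ c ‖ = r
    plane : (n : ℝ³) (d : ℝ) → ‖ n ‖² ≈ 1# → Sphere      -- n · v = d, and ∞

  surface : Sphere → Pred ℝ̂³ 0ℓ
  surface (round c r _) (fin v) = ‖ v ⊖ c ‖² ≈ r * r
  surface (round c r _) ∞       = ⊥
  surface (plane n d _) (fin v) = n · v ≈ d
  surface (plane n d _) ∞       = ⊤

  -- The two components of the complement: for a round sphere, negative is
  -- the ball and positive the exterior; for a plane, the two sides n · v < d
  -- and d < n · v.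
  data Side : Set where
    negative positive : Side

  component : Sphere → Side → Pred ℝ̂³ 0ℓ
  component (round c r _) negative (fin v) = ‖ v ⊖ c ‖² < r * r
  component (round c r _) positive (fin v) = r * r < ‖ v ⊖ c ‖²
  component (round c r _) negative ∞       = ⊥
  component (round c r _) positive ∞       = ⊤
  component (plane n d _) negative (fin v) = n · v < d
  component (plane n d _) positive (fin v) = d < n · v
  component (plane n d _) negative ∞       = ⊥
  component (plane n d _) positive ∞       = ⊥

  record OrientedSphere : Set where
    constructor orient
    field
      sphere : Sphere
      side   : Side

    region : Pred ℝ̂³ 0ℓ
    region = component sphere side

  open OrientedSphere public

  bend : OrientedSphere → ℝ
  bend (orient (round _ r 0<r) negative) = proj₁ (inverse r (pos⇒≉0 0<r))
  bend (orient (round _ r 0<r) positive) = - proj₁ (inverse r (pos⇒≉0 0<r))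
  bend (orient (plane _ _ _) _)          = 0#

  -- Distinct parameters may describe the same oriented sphere.
  infix 4 _≅_

  _≅_ : Rel OrientedSphere 0ℓ
  S ≅ S′ = surface (sphere S) ≐ surface (sphere S′) × region S ≐ region S′

  -- Meeting in exactly one point of ℝ̂³; parallel planes are tangent at ∞.
  Tangent : Rel Sphere 0ℓ
  Tangent S T = ∃ λ p → p ∈ surface S ∩ surface T ×
                        (∀ q → q ∈ surface S ∩ surface T → q ≋ p)

  Disjoint : Rel Sphere 0ℓ
  Disjoint S T = Empty (surface S ∩ surface T)

  normal : Sphere → ℝ³ → ℝ³
  normal (round c _ _) v = v ⊖ c
  normal (plane n _ _) _ = n

  -- The spheres meet, and at right angles at every common finite point.
  -- Orthogonal spheres meet along a circle or a line, so there are always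
  -- common points other than ∞.
  Orthogonal : Rel Sphere 0ℓ
  Orthogonal S T =
    (∃ λ v → fin v ∈ surface S ∩ surface T) ×
    (∀ v → fin v ∈ surface S ∩ surface T → normal S v · normal T v ≈ 0#)

  -- ‖ v ⊖ c ‖² ≈ 0# says that v is the centre c.
  inversion : Sphere → ℝ̂³ → ℝ̂³
  inversion (round c r _) (fin v) with ‖ v ⊖ c ‖² ≟ 0#
  ... | yes _ = ∞
  ... | no ≉0 = fin (c ⊕ (r * r * proj₁ (inverse ‖ v ⊖ c ‖² ≉0)) ⊛ (v ⊖ c))
  inversion (round c r _) ∞       = fin c
  inversion (plane n d _) (fin v) = fin (v ⊖ (2# * (n · v - d)) ⊛ n)
  inversion (plane n d _) ∞       = ∞

  -- The full Möbius group, orientation-reversing maps included, is the group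
  -- generated by the inversions; these are their own inverses.
  data IsMöbius : Pred (ℝ̂³ → ℝ̂³) 0ℓ where
    identity : IsMöbius id
    invert   : ∀ {φ} (T : Sphere) → IsMöbius φ → IsMöbius (inversion T ∘ φ)

  MapsTo : (ℝ̂³ → ℝ̂³) → Rel OrientedSphere 0ℓ
  MapsTo φ S S′ = image φ (surface (sphere S)) ≐ surface (sphere S′) ×
                  image φ (region S) ≐ region S′

  -- The spheres S₁, …, S₈ have the indices 0, …, 7 of Fin 8.
  Configuration : Set
  Configuration = Fin 8 → OrientedSphere

  ConfigurationMapsTo : (ℝ̂³ → ℝ̂³) → Rel Configuration 0ℓ
  ConfigurationMapsTo φ V W = ∀ k → MapsTo φ (V k) (W k)

  ball : ℝ³ → (r : ℝ) → 0# < r → OrientedSphere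
  ball c r 0<r = orient (round c r 0<r) negative

  e₃ : ℝ³
  e₃ = ⟨ 0# , 0# , 1# ⟩

  ‖e₃‖²≈1 : ‖ e₃ ‖² ≈ 1#
  ‖e₃‖²≈1 = trans (+-cong (trans (+-cong (zeroˡ 0#) (zeroˡ 0#)) (+-identityˡ 0#))
                          (*-identityˡ 1#))
                  (+-identityˡ 1#)

  IsSqrt2 : Pred ℝ 0ℓ
  IsSqrt2 s = 0# < s × s * s ≈ 2#

  -- The argument is √2.
  standard : ℝ → Configuration
  standard √2 = lookup
    ( orient (plane e₃ 1# ‖e₃‖²≈1) positive
    ∷ orient (plane e₃ (- 1#) ‖e₃‖²≈1) negative
    ∷ ball ⟨ √2 , 0# , 0# ⟩ 1# 0<1
    ∷ ball ⟨ 0# , √2 , 0# ⟩ 1# 0<1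
    ∷ ball ⟨ 0# , 0# , - ½ ⟩ ½ 0<½
    ∷ ball ⟨ 0# , 0# , ½ ⟩ ½ 0<½
    ∷ ball ⟨ - √2 , 0# , 0# ⟩ 1# 0<1
    ∷ ball ⟨ 0# , - √2 , 0# ⟩ 1# 0<1
    ∷ [] )

  IsOrthoplicial : Pred Configuration 0ℓ
  IsOrthoplicial V =
    ∃ λ √2 → IsSqrt2 √2 × ∃ λ φ → IsMöbius φ × ConfigurationMapsTo φ (standard √2) V

  IsAdmissible : Pred Configuration 0ℓ
  IsAdmissible V = ∀ i j → i ≢ j →
    (toℕ i % 4 ≢ toℕ j % 4 → Tangent (sphere (V i)) (sphere (V j))) ×
    (toℕ i % 4 ≡ toℕ j % 4 → Disjoint (sphere (V i)) (sphere (V j)))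

  record Quadruple (V : Configuration) : Set where
    field
      index           : Fin 4 → Fin 8
      injective       : Injective _≡_ _≡_ index
      pairwiseTangent : ∀ i j → i ≢ j →
                        Tangent (sphere (V (index i))) (sphere (V (index j)))

  IsDual : (V : Configuration) → Quadruple V → Pred Sphere 0ℓ
  IsDual V F T = ∀ i → Orthogonal T (sphere (V (Quadruple.index F i)))

  -- The configurations in the packing generated by V.  W′ k is the image of
  -- W k, so inverting keeps the indices of the spheres.
  data Family (V : Configuration) : Pred Configuration 0ℓ where
    initial : V ∈ Family V
    reflect : ∀ {W W′} → W ∈ Family V →
              (F : Quadruple W) (T : Sphere) → T ∈ IsDual W F →
              ConfigurationMapsTo (inversion T) W W′ →
              W′ ∈ Family V

  packing : Configuration → Pred OrientedSphere 0ℓ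
  packing V S = ∃ λ W → W ∈ Family V × ∃ λ k → S ≅ W k

  bends : Pred OrientedSphere 0ℓ → Pred ℝ 0ℓ
  bends P b = ∃ λ S → S ∈ P × bend S ≈ b

  IsIntegral : Pred (Pred OrientedSphere 0ℓ) 0ℓ
  IsIntegral P = ∀ b → b ∈ bends P → ∃ λ n → b ≈ fromℤ n

  integerBends : Pred OrientedSphere 0ℓ → Pred ℤ 0ℓ
  integerBends P n = fromℤ n ∈ bends P

  IsPrimitive : Pred (Pred OrientedSphere 0ℓ) 0ℓ
  IsPrimitive P = IsIntegral P × IsGCD (integerBends P) (+ 1)

{-# OPTIONS --safe #-}

-- Oriented spheres are unit vectors and points of ℝ̂³ are null vectors of a
-- Lorentzian space ℝ⁵, on which inversions act as reflections.  Hence every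
-- orthoplicial configuration has the Gram matrix of the standard one, and
-- its bends are the pairings with the null vector of the point ∞.  Parseval's
-- identity for that vector is the relation
--     s² = 2 (s Σb − Σb²),
-- where b runs over four spheres from distinct antipodal pairs and s is the
-- sum of two antipodal bends.  Inversion in a dual sphere fixes four of the
-- bends and adds 2 (Σb − s) to the others; for integers the relation makes
-- Σb − s even, so no bend changes modulo 4 within the packing.  Modulo 8 the
-- relation leaves only two cases for the residues modulo 4: the claimed
-- pattern, or all bends even, which primitivity excludes.

module Submission where

open import Defs
import Algebra.Properties.Ring as RingProperties
import Algebra.Properties.Semiring.Mult.TCOptimised as Multiples
import Algebra.Solver.Ring as RingSolver
import Algebra.Solver.Ring.AlmostCommutativeRing as ACR
open import Data.Empty using (⊥-elim)
open import Data.Fin.Base using (Fin; toℕ; punchOut; _↑ˡ_; _↑ʳ_)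
open import Data.Fin.Patterns using (0F; 1F; 2F; 3F; 4F; 5F; 6F; 7F)
open import Data.Fin.Permutation as Perm
  using (Permutation′; _⟨$⟩ʳ_; _⟨$⟩ˡ_; _∘ₚ_; transpose; inverseˡ; inverseʳ)
open import Data.Fin.Properties as Fin
  using (all?; any?; toℕ-fromℕ<; punchOut-injective; injective⇒≤)
open import Data.Integer.Base as ℤ using (ℤ; +_; -[1+_])
open import Data.Integer.Divisibility.Signed
import Data.Integer.Properties as ℤ
open import Data.Maybe.Base as Maybe using (Maybe)
open import Data.Nat.Base as ℕ using (suc; zero)
open import Data.Nat.DivMod using (_%_; _mod_; m%n<n)
import Data.Nat.Properties as ℕ
open import Data.Product using (∃; _×_; _,_; proj₁; proj₂)
open import Data.Sum.Base as Sum using (_⊎_; inj₁; inj₂)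
open import Data.Unit.Base using (tt)
open import Data.Vec.Base using ([]; _∷_; lookup)
open import Function.Base using (id; _∘_)
open import Function.Definitions using (Injective)
open import Relation.Binary.Definitions using (tri<; tri≈; tri>)
open import Relation.Binary.PropositionalEquality.Core as ≡ using (_≡_; _≢_)
import Relation.Binary.Reasoning.Setoid as SetoidReasoning
open import Relation.Binary.Structures using (IsStrictTotalOrder)
open import Relation.Nullary.Decidable
  using (Dec; yes; no; toWitness; dec⇒maybe; _×-dec_; _⊎-dec_; _→-dec_; ¬?)
open import Relation.Nullary.Negation.Core using (¬_; contradiction)
open import Relation.Unary using (_∈_)

-- The obstacle is that spheres and their images are point sets, while the algebra concerns vectors.
-- The bridge is a uniqueness statement: a vector of square 2 that is orthogonal to all points of a
-- surface and pairs positively with all points of the region has the same pairings as the vector of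
-- the sphere. A Möbius map acts on null vectors only up to a positive factor, which such conditions
-- do not see. Vectors are compared through their pairings with all vectors, and every fact about a
-- configuration is recorded as an identity between pairings, so that it travels along an isometry
-- without any linear algebra. A dual sphere is never constructed. The pairings of its vector `t`,
-- known only up to sign, follow from Parseval's identity and orthogonality to four spheres, and the
-- jump of a bend is quadratic in `t`. Since inversions keep the indices, each index has a fixed
-- residue modulo 4 throughout the packing, and the permutation found for the initial configuration
-- serves all the others.

-- Residues modulo 4 and modulo 8

module ResidueArithmetic where
  open import Data.Fin.Base using (fromℕ<)
  open import Data.Integer.Base using (-_; 0ℤ; 1ℤ; -1ℤ; _+_; _-_; _*_)
  open import Data.Integer.DivMod using (_/ℕ_; a≡a%ℕn+[a/ℕn]*n; n%ℕd<d)
  open import Data.Integer.Properties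
    using (abs-*; *-cancelˡ-≡; *-comm; i≡j⇒i-j≡0; +-identityˡ; neg-involutive)
  open import Data.Integer.Solver using (module +-*-Solver)
  open import Data.Integer.Tactic.RingSolver using (solve-∀)
  open import Data.Nat.Divisibility as ℕ using ()
  open import Data.Nat.Primality using (prime?; euclidsLemma)
  open import Relation.Binary.PropositionalEquality.Core using (refl; sym; trans; cong; cong₂; subst)
  open +-*-Solver using (Polynomial; con; solve; _:+_; _:-_; _:*_; :-_; _:=_)

  swapClasses : Fin 4 → Fin 4 → Permutation′ 8
  swapClasses c d = transpose (c ↑ˡ 4) (d ↑ˡ 4) ∘ₚ transpose (4 ↑ʳ c) (4 ↑ʳ d)

  flipClass : Fin 4 → Fin 2 → Permutation′ 8
  flipClass c 0F = Perm.id
  flipClass c 1F = transpose (c ↑ˡ 4) (4 ↑ʳ c)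

  -- One permutation for each pair of classes that 0 and 1 may be sent to.
  moveClasses : Fin 6 → Permutation′ 8
  moveClasses = lookup
    ( Perm.id ∷ swapClasses 1F 2F ∷ swapClasses 1F 3F ∷ swapClasses 0F 2F ∷ swapClasses 0F 3F
    ∷ swapClasses 0F 2F ∘ₚ swapClasses 1F 3F ∷ [] )

  -- The pattern of residues is symmetric in the two classes with residue ε, so a permutation only
  -- has to choose which two classes are even and, within each of them, which member is 0 and which
  -- is 2 modulo 4. These 6 · 2 · 2 elements of the group of order 384 suffice. The flips act first,
  -- on the positions of the pattern.
  symmetry : Fin 6 → Fin 2 → Fin 2 → Permutation′ 8
  symmetry i f g = flipClass 0F f ∘ₚ flipClass 1F g ∘ₚ moveClasses i

  SameClass : Fin 8 → Fin 8 → Set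
  SameClass k l = toℕ k % 4 ≡ toℕ l % 4

  sameClass? : ∀ k l → Dec (SameClass k l)
  sameClass? k l = toℕ k % 4 ℕ.≟ toℕ l % 4

  abstract
    -- Whether two distinct spheres of a configuration are tangent or disjoint depends only on
    -- whether they share a class; `symmetric-admissible` uses one direction for each of the two
    -- relations.
    symmetry-classes : ∀ i f g k l →
      (SameClass (symmetry i f g ⟨$⟩ʳ k) (symmetry i f g ⟨$⟩ʳ l) → SameClass k l) ×
      (SameClass k l → SameClass (symmetry i f g ⟨$⟩ʳ k) (symmetry i f g ⟨$⟩ʳ l))
    symmetry-classes = toWitness
      {a? = all? λ i → all? λ f → all? λ g → all? λ k → all? λ l →
            let k′ = symmetry i f g ⟨$⟩ʳ k ; l′ = symmetry i f g ⟨$⟩ʳ l in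
            (sameClass? k′ l′ →-dec sameClass? k l) ×-dec (sameClass? k l →-dec sameClass? k′ l′)} _

  residue : ℤ → Fin 8 → ℤ
  residue ε = lookup (0ℤ ∷ 0ℤ ∷ ε ∷ ε ∷ + 2 ∷ + 2 ∷ ε ∷ ε ∷ [])

  unit : Fin 2 → ℤ
  unit = lookup (1ℤ ∷ -1ℤ ∷ [])

  unit-±1 : ∀ e → unit e ≡ 1ℤ ⊎ unit e ≡ -1ℤ
  unit-±1 0F = inj₁ refl
  unit-±1 1F = inj₂ refl

  -- The even residues differ from -ε in parity, and 2 ε is not divisible by 4.
  residue≢-unit : ∀ e k → ¬ (+ 4 ∣ residue (unit e) k - - unit e)
  residue≢-unit = toWitness {a? = all? λ e → all? λ k → ¬? (+ 4 ∣? residue (unit e) k - - unit e)} _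

  antipodalExtension : (a b c d s : ℤ) → Fin 8 → ℤ
  antipodalExtension a b c d s = lookup (a ∷ b ∷ c ∷ d ∷ s - a ∷ s - b ∷ s - c ∷ s - d ∷ [])

  -- The relation of the record Descartes below for s = 2σ, halved, with all terms
  -- on one side.
  descartesForm : (σ a b c d : ℤ) → ℤ
  descartesForm σ a b c d =
    a * a + b * b + c * c + d * d + + 2 * (σ * σ) - + 2 * (σ * (a + b + c + d))

  ⌊_⌋ : Fin 4 → ℤ
  ⌊ r ⌋ = + toℕ r

  abstract
    -- The hypothesis is a congruence because residues modulo 4 determine the form only modulo 8.
    -- The form equals Σ (x - σ)² - 2 σ², with x running over a, b, c, d. For even σ, four squares
    -- adding up to a multiple of 8 are all even, hence so are all bends. For odd σ, exactly two of
    -- the x - σ are odd; their classes consist of 0 and 2, since antipodal bends then add up to 2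
    -- modulo 4. The other two are congruent modulo 4, which gives a common ε. The proof itself is a
    -- check of 1024 cases.
    residues-classified : ∀ t a b c d → + 8 ∣ descartesForm ⌊ t ⌋ ⌊ a ⌋ ⌊ b ⌋ ⌊ c ⌋ ⌊ d ⌋ →
      + 2 ∣ ⌊ a ⌋ + ⌊ b ⌋ + ⌊ c ⌋ + ⌊ d ⌋ ×
      ((∀ k → + 2 ∣ antipodalExtension ⌊ a ⌋ ⌊ b ⌋ ⌊ c ⌋ ⌊ d ⌋ (+ 2 * ⌊ t ⌋) k) ⊎
       ∃ λ e → ∃ λ i → ∃ λ f → ∃ λ g → ∀ k →
         + 4 ∣ antipodalExtension ⌊ a ⌋ ⌊ b ⌋ ⌊ c ⌋ ⌊ d ⌋ (+ 2 * ⌊ t ⌋) (symmetry i f g ⟨$⟩ʳ k)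
               - residue (unit e) k)
    residues-classified = toWitness
      {a? = all? λ t → all? λ a → all? λ b → all? λ c → all? λ d →
        (+ 8 ∣? descartesForm ⌊ t ⌋ ⌊ a ⌋ ⌊ b ⌋ ⌊ c ⌋ ⌊ d ⌋) →-dec
        ((+ 2 ∣? ⌊ a ⌋ + ⌊ b ⌋ + ⌊ c ⌋ + ⌊ d ⌋) ×-dec
         ((all? λ k → + 2 ∣? antipodalExtension ⌊ a ⌋ ⌊ b ⌋ ⌊ c ⌋ ⌊ d ⌋ (+ 2 * ⌊ t ⌋) k) ⊎-dec
          (any? λ e → any? λ i → any? λ f → any? λ g → all? λ k →
            + 4 ∣? antipodalExtension ⌊ a ⌋ ⌊ b ⌋ ⌊ c ⌋ ⌊ d ⌋ (+ 2 * ⌊ t ⌋) (symmetry i f g ⟨$⟩ʳ k)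
                  - residue (unit e) k)))} _

  residueMod4 : ∀ a → ∃ λ r → ∃ λ q → a ≡ ⌊ r ⌋ + + 4 * q
  residueMod4 a = fromℕ< (n%ℕd<d a 4) , a /ℕ 4 ,
    trans (a≡a%ℕn+[a/ℕn]*n a 4)
          (cong₂ _+_ (cong +_ (sym (toℕ-fromℕ< (n%ℕd<d a 4)))) (*-comm (a /ℕ 4) (+ 4)))

  square-even : ∀ s → + 2 ∣ s * s → + 2 ∣ s
  square-even s 2∣s² with euclidsLemma ℤ.∣ s ∣ ℤ.∣ s ∣ (toWitness {a? = prime? 2} _)
                            (subst (2 ℕ.∣_) (abs-* s s) (∣⇒∣ᵤ 2∣s²))
  ... | inj₁ 2∣s = ∣ᵤ⇒∣ 2∣s
  ... | inj₂ 2∣s = ∣ᵤ⇒∣ 2∣s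

  -- The analogue of Descartes' circle theorem: `a`, `b`, `c`, `d` are bends from the four antipodal
  -- classes and `s` is the sum of two antipodal bends.
  record Descartes (a b c d s : ℤ) : Set where
    constructor descartes
    field
      relation : s * s ≡ + 2 * (s * (a + b + c + d) - (a * a + b * b + c * c + d * d))

  descartesPolynomial : ∀ {n} (σ a b c d : Polynomial n) → Polynomial n
  descartesPolynomial σ a b c d =
    a :* a :+ b :* b :+ c :* c :+ d :* d :+ con (+ 2) :* (σ :* σ)
    :- con (+ 2) :* (σ :* (a :+ b :+ c :+ d))

  descartesForm-vanishes : ∀ σ a b c d → Descartes a b c d (σ * + 2) → descartesForm σ a b c d ≡ 0ℤ
  descartesForm-vanishes σ a b c d (descartes relation) =
    *-cancelˡ-≡ (+ 2) _ _ (trans (expand σ a b c d) (i≡j⇒i-j≡0 relation))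
    where
    expand : ∀ σ a b c d → + 2 * descartesForm σ a b c d ≡
             (σ * + 2) * (σ * + 2) - + 2 * ((σ * + 2) * (a + b + c + d) - (a * a + b * b + c * c + d * d))
    expand = solve 5 (λ σ a b c d → con (+ 2) :* descartesPolynomial σ a b c d :=
      (σ :* con (+ 2)) :* (σ :* con (+ 2)) :-
      con (+ 2) :* ((σ :* con (+ 2)) :* (a :+ b :+ c :+ d) :- (a :* a :+ b :* b :+ c :* c :+ d :* d))) refl

  -- A square (x + 4 x′)² exceeds x² by 8 (x x′ + 2 x′²), and the product 2 σ (a + b + c + d)
  -- changes by twice a multiple of 4.
  descartesForm-mod-8 : ∀ t a b c d t′ a′ b′ c′ d′ →
    + 8 ∣ descartesForm (t + + 4 * t′) (a + + 4 * a′) (b + + 4 * b′) (c + + 4 * c′) (d + + 4 * d′)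
          - descartesForm t a b c d
  descartesForm-mod-8 t a b c d t′ a′ b′ c′ d′ = divides
    (square a a′ + square b b′ + square c c′ + square d d′ + + 2 * square t t′
     - (t * (a′ + b′ + c′ + d′) + t′ * (a + b + c + d) + + 4 * (t′ * (a′ + b′ + c′ + d′))))
    (solve 10 (λ t a b c d t′ a′ b′ c′ d′ →
      descartesPolynomial (t ∔ t′) (a ∔ a′) (b ∔ b′) (c ∔ c′) (d ∔ d′)
        :- descartesPolynomial t a b c d :=
      (squareₚ a a′ :+ squareₚ b b′ :+ squareₚ c c′ :+ squareₚ d d′ :+ con (+ 2) :* squareₚ t t′
       :- (t :* (a′ :+ b′ :+ c′ :+ d′) :+ t′ :* (a :+ b :+ c :+ d)
           :+ con (+ 4) :* (t′ :* (a′ :+ b′ :+ c′ :+ d′)))) :* con (+ 8))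
    refl t a b c d t′ a′ b′ c′ d′)
    where
    square : ℤ → ℤ → ℤ
    square x x′ = x * x′ + + 2 * (x′ * x′)
    squareₚ _∔_ : ∀ {n} → Polynomial n → Polynomial n → Polynomial n
    squareₚ x x′ = x :* x′ :+ con (+ 2) :* (x′ :* x′)
    x ∔ x′ = x :+ con (+ 4) :* x′

  Classified : (a b c d s : ℤ) → Set
  Classified a b c d s =
    + 2 ∣ a + b + c + d - s ×
    ((∀ k → + 2 ∣ antipodalExtension a b c d s k) ⊎
     ∃ λ e → ∃ λ i → ∃ λ f → ∃ λ g → ∀ k →
       + 4 ∣ antipodalExtension a b c d s (symmetry i f g ⟨$⟩ʳ k) - residue (unit e) k)

  antipodalExtension-mod-4 : ∀ t a b c d t′ a′ b′ c′ d′ k →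
    + 4 ∣ antipodalExtension (a + + 4 * a′) (b + + 4 * b′) (c + + 4 * c′) (d + + 4 * d′)
                             ((t + + 4 * t′) * + 2) k
          - antipodalExtension a b c d (+ 2 * t) k
  antipodalExtension-mod-4 t a b c d t′ a′ b′ c′ d′ = λ where
      0F → divides a′ (low a a′)
      1F → divides b′ (low b b′)
      2F → divides c′ (low c c′)
      3F → divides d′ (low d d′)
      4F → divides (+ 2 * t′ - a′) (high t t′ a a′)
      5F → divides (+ 2 * t′ - b′) (high t t′ b b′)
      6F → divides (+ 2 * t′ - c′) (high t t′ c c′)
      7F → divides (+ 2 * t′ - d′) (high t t′ d d′)
    where
    low : ∀ a a′ → a + + 4 * a′ - a ≡ a′ * + 4
    low = solve-∀
    high : ∀ t t′ a a′ → (t + + 4 * t′) * + 2 - (a + + 4 * a′) - (+ 2 * t - a) ≡ (+ 2 * t′ - a′) * + 4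
    high = solve-∀

  ∣-difference : ∀ {i m n} → i ∣ m - n → i ∣ n → i ∣ m
  ∣-difference {n = n} p q = ∣m+n∣n⇒∣m p (∣m⇒∣-m q)

  ∣-chain : ∀ {i} l m n → i ∣ l - m → i ∣ m - n → i ∣ l - n
  ∣-chain {i} l m n p q = subst (i ∣_) (telescope l m n) (∣m∣n⇒∣m+n p q)
    where
    telescope : ∀ l m n → l - m + (m - n) ≡ l - n
    telescope = solve-∀

  2∣4 : + 2 ∣ + 4
  2∣4 = divides (+ 2) refl

  sum-mod-2 : ∀ a b c d a′ b′ c′ d′ t t′ →
    a + + 4 * a′ + (b + + 4 * b′) + (c + + 4 * c′) + (d + + 4 * d′) - (t + + 4 * t′) * + 2
    - (a + b + c + d) ≡ (+ 2 * (a′ + b′ + c′ + d′) - t - + 4 * t′) * + 2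
  sum-mod-2 = solve-∀

  classify-residues : ∀ t a b c d t′ a′ b′ c′ d′ →
    descartesForm (⌊ t ⌋ + + 4 * t′) (⌊ a ⌋ + + 4 * a′) (⌊ b ⌋ + + 4 * b′) (⌊ c ⌋ + + 4 * c′)
                  (⌊ d ⌋ + + 4 * d′) ≡ 0ℤ →
    Classified (⌊ a ⌋ + + 4 * a′) (⌊ b ⌋ + + 4 * b′) (⌊ c ⌋ + + 4 * c′) (⌊ d ⌋ + + 4 * d′)
               ((⌊ t ⌋ + + 4 * t′) * + 2)
  classify-residues t a b c d t′ a′ b′ c′ d′ vanishes =
    -- The antipodal sum is even, so subtracting it does not affect the parity of the sum of the
    -- residues.
    ∣-difference
      (divides (+ 2 * (a′ + b′ + c′ + d′) - ⌊ t ⌋ - + 4 * t′)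
               (sum-mod-2 ⌊ a ⌋ ⌊ b ⌋ ⌊ c ⌋ ⌊ d ⌋ a′ b′ c′ d′ ⌊ t ⌋ t′))
      (proj₁ residues) ,
    Sum.map
      (λ h k → ∣-difference (∣-trans 2∣4 (congruent k)) (h k))
      (λ (e , i , f , g , h) → e , i , f , g , λ k →
        ∣-chain (extension (symmetry i f g ⟨$⟩ʳ k)) (residues₀ (symmetry i f g ⟨$⟩ʳ k))
          (residue (unit e) k) (congruent (symmetry i f g ⟨$⟩ʳ k)) (h k))
      (proj₂ residues)
    where
    extension residues₀ : Fin 8 → ℤ
    extension = antipodalExtension (⌊ a ⌋ + + 4 * a′) (⌊ b ⌋ + + 4 * b′) (⌊ c ⌋ + + 4 * c′)
                  (⌊ d ⌋ + + 4 * d′) ((⌊ t ⌋ + + 4 * t′) * + 2)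
    residues₀ = antipodalExtension ⌊ a ⌋ ⌊ b ⌋ ⌊ c ⌋ ⌊ d ⌋ (+ 2 * ⌊ t ⌋)
    congruent : ∀ k → + 4 ∣ extension k - residues₀ k
    congruent = antipodalExtension-mod-4 ⌊ t ⌋ ⌊ a ⌋ ⌊ b ⌋ ⌊ c ⌋ ⌊ d ⌋ t′ a′ b′ c′ d′
    residues = residues-classified t a b c d
      -- The form itself is 0, so the congruence reads 8 ∣ 0 - f, where f is the form of the
      -- residues; the outer steps remove the zero and the sign.
      (subst (+ 8 ∣_) (trans (cong -_ (+-identityˡ (- _))) (neg-involutive _))
        (∣m⇒∣-m (subst (λ z → + 8 ∣ z - descartesForm ⌊ t ⌋ ⌊ a ⌋ ⌊ b ⌋ ⌊ c ⌋ ⌊ d ⌋) vanishes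
          (descartesForm-mod-8 ⌊ t ⌋ ⌊ a ⌋ ⌊ b ⌋ ⌊ c ⌋ ⌊ d ⌋ t′ a′ b′ c′ d′))))

  classify : ∀ a b c d s → Descartes a b c d s → Classified a b c d s
  classify a b c d s D
    -- The relation exhibits s² as twice an integer, so s = 2 σ. It is σ, not s, that is reduced
    -- modulo 4, which retains s modulo 8.
    with divides σ refl ← square-even s (subst (+ 2 ∣_) (sym (Descartes.relation D))
           (∣m⇒∣m*n (s * (a + b + c + d) - (a * a + b * b + c * c + d * d)) ∣-refl))
    with (t , t′ , refl) ← residueMod4 σ
       | (a₀ , a′ , refl) ← residueMod4 a
       | (b₀ , b′ , refl) ← residueMod4 b
       | (c₀ , c′ , refl) ← residueMod4 c
       | (d₀ , d′ , refl) ← residueMod4 d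
    = classify-residues t a₀ b₀ c₀ d₀ t′ a′ b′ c′ d′
        (descartesForm-vanishes (⌊ t ⌋ + + 4 * t′) (⌊ a₀ ⌋ + + 4 * a′) (⌊ b₀ ⌋ + + 4 * b′)
          (⌊ c₀ ⌋ + + 4 * c′) (⌊ d₀ ⌋ + + 4 * d′) D)

  i∣i-i : ∀ {k} i → k ∣ i - i
  i∣i-i {k} i = divides (+ 0) (i≡j⇒i-j≡0 (refl {x = i}))

  ∣-sym : ∀ {k} i j → k ∣ i - j → k ∣ j - i
  ∣-sym {k} i j k∣ = subst (k ∣_) (solve 2 (λ i j → :- (i :- j) := j :- i) refl i j) (∣m⇒∣-m k∣)

  ∣-shift : ∀ n e → + 2 ∣ e → + 4 ∣ n + + 2 * e - n
  ∣-shift n e 2∣e = subst (+ 4 ∣_) (solve 2 (λ n x → x := n :+ x :- n) refl n (+ 2 * e)) (*-monoʳ-∣ (+ 2) 2∣e)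

open ResidueArithmetic

-- Integers and positivity in an ordered field

module OrderedField (ℛ : CompleteOrderedField) where
  open Geometry ℛ
  open CompleteOrderedField ℛ renaming (Carrier to ℝ) 
  open IsStrictTotalOrder isStrictTotalOrder
    using (compare; _≟_; <-respˡ-≈; <-respʳ-≈)
    renaming (irrefl to <-irrefl; trans to <-trans)
  open RingProperties ring
  open SetoidReasoning setoid

  module Numerals where
    open Multiples semiring renaming (_×_ to _×′_)

    -- fromℤ (+ 2) is 1# + (1# + 0#), whereas num (+ 2) is 2# by computation.
    num : ℤ → ℝ
    num (+ n)    = n ×′ 1#
    num -[1+ n ] = - (suc n ×′ 1#)

    num-⊖ : ∀ m n → num (m ℤ.⊖ n) ≈ m ×′ 1# - n ×′ 1#
    num-⊖ zero    zero    = sym (-‿inverseʳ 0#)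
    num-⊖ zero    (suc n) = sym (+-identityˡ _)
    num-⊖ (suc m) zero    = sym (trans (+-congˡ -0#≈0#) (+-identityʳ _))
    num-⊖ (suc m) (suc n) = begin
      num (suc m ℤ.⊖ suc n)          ≡⟨ ≡.cong num (ℤ.[1+m]⊖[1+n]≡m⊖n m n) ⟩
      num (m ℤ.⊖ n)                  ≈⟨ num-⊖ m n ⟩
      m ×′ 1# - n ×′ 1#                ≈⟨ +-congʳ (sym (trans (+-assoc _ _ _)
                                          (trans (+-congˡ (-‿inverseʳ 1#)) (+-identityʳ _)))) ⟩
      m ×′ 1# + 1# - 1# - n ×′ 1#      ≈⟨ +-assoc _ _ _ ⟩
      m ×′ 1# + 1# + (- 1# - n ×′ 1#)  ≈⟨ +-cong (trans (+-comm _ _) (sym (1+× m 1#)))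
                                          (trans (-‿+-comm _ _) (-‿cong (sym (1+× n 1#)))) ⟩
      suc m ×′ 1# - suc n ×′ 1#        ∎

    num-+ : ∀ i j → num (i ℤ.+ j) ≈ num i + num j
    num-+ (+ m)    (+ n)    = ×-homo-+ 1# m n
    num-+ (+ m)    -[1+ n ] = num-⊖ m (suc n)
    num-+ -[1+ m ] (+ n)    = trans (num-⊖ n (suc m)) (+-comm _ _)
    num-+ -[1+ m ] -[1+ n ] = begin
      - (suc (suc (m ℕ.+ n)) ×′ 1#)     ≡⟨ ≡.cong (λ k → - (suc k ×′ 1#)) (ℕ.+-suc m n) ⟨
      - ((suc m ℕ.+ suc n) ×′ 1#)       ≈⟨ -‿cong (×-homo-+ 1# (suc m) (suc n)) ⟩
      - (suc m ×′ 1# + suc n ×′ 1#)      ≈⟨ -‿+-comm _ _ ⟨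
      - (suc m ×′ 1#) - suc n ×′ 1#      ∎

    num-neg : ∀ i → num (ℤ.- i) ≈ - num i
    num-neg (+ zero)  = sym -0#≈0#
    num-neg (+ suc n) = refl
    num-neg -[1+ n ]  = sym (-‿involutive _)

    num-pos-* : ∀ m j → num (+ m ℤ.* j) ≈ num (+ m) * num j
    num-pos-* m (+ n)    = trans (reflexive (≡.cong num (≡.sym (ℤ.pos-* m n)))) (×1-homo-* m n)
    num-pos-* m -[1+ n ] = begin
      num (+ m ℤ.* -[1+ n ])           ≡⟨ ≡.cong num (ℤ.neg-distribʳ-* (+ m) (+ suc n)) ⟨
      num (ℤ.- (+ m ℤ.* + suc n))      ≈⟨ num-neg (+ m ℤ.* + suc n) ⟩
      - num (+ m ℤ.* + suc n)          ≈⟨ -‿cong (num-pos-* m (+ suc n)) ⟩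
      - (num (+ m) * num (+ suc n))    ≈⟨ -‿distribʳ-* _ _ ⟩
      num (+ m) * num -[1+ n ]         ∎

    num-* : ∀ i j → num (i ℤ.* j) ≈ num i * num j
    num-* (+ m)    j = num-pos-* m j
    num-* -[1+ m ] j = begin
      num (-[1+ m ] ℤ.* j)             ≡⟨ ≡.cong num (ℤ.neg-distribˡ-* (+ suc m) j) ⟨
      num (ℤ.- (+ suc m ℤ.* j))        ≈⟨ num-neg (+ suc m ℤ.* j) ⟩
      - num (+ suc m ℤ.* j)            ≈⟨ -‿cong (num-pos-* (suc m) j) ⟩
      - (num (+ suc m) * num j)        ≈⟨ -‿distribˡ-* _ _ ⟩
      num -[1+ m ] * num j             ∎

    fromℤ≈num : ∀ i → fromℤ i ≈ num i
    fromℤ≈num (+ n)    = ×ᵤ≈× n 1#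
    fromℤ≈num -[1+ n ] = -‿cong (×ᵤ≈× (suc n) 1#)

    ℝ-almostCommutativeRing : ACR.AlmostCommutativeRing _ _
    ℝ-almostCommutativeRing = ACR.fromCommutativeRing commutativeRing

    -- Integer coefficients let the ring solver evaluate numerals: equality in ℤ computes, whereas
    -- equality in an abstract field does not.
    num-homomorphism : ℤ.+-*-rawRing ACR.-Raw-AlmostCommutative⟶ ℝ-almostCommutativeRing
    num-homomorphism = record
      { ⟦_⟧    = num
      ; +-homo = num-+
      ; *-homo = num-*
      ; -‿homo = num-neg
      ; 0-homo = refl
      ; 1-homo = refl
      }

    num-weak≟ : ∀ i j → Maybe (num i ≈ num j)
    num-weak≟ i j = Maybe.map (λ i≡j → reflexive (≡.cong num i≡j)) (dec⇒maybe (i ℤ.≟ j))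

    num-pos : ∀ n → 0# < num (+ suc n)
    num-pos zero    = 0<1
    num-pos (suc n) = <-trans (num-pos n) (<-respˡ-≈ (+-identityʳ _) (+-monoʳ-< _ 0<1))

  open Numerals using (num; num-pos) public
  open RingSolver ℤ.+-*-rawRing Numerals.ℝ-almostCommutativeRing Numerals.num-homomorphism
    Numerals.num-weak≟
    using (solve; Polynomial; con; _:+_; _:*_; _:-_; :-_; _:=_) public

  -- The last hypothesis says x − y = k (u − v), free of subtraction.
  eliminate : ∀ {x y} k {u v} → u ≈ v → x + k * v ≈ y + k * u → x ≈ y
  eliminate {x} {y} k {u} {v} u≈v eq = begin
    x                    ≈⟨ solve 3 (λ x k v → x := x :+ k :* v :- k :* v) refl x k v ⟩
    x + k * v - k * v    ≈⟨ +-congʳ eq ⟩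
    y + k * u - k * v    ≈⟨ +-congʳ (+-congˡ (*-congˡ u≈v)) ⟩
    y + k * v - k * v    ≈⟨ solve 3 (λ y k v → y :+ k :* v :- k :* v := y) refl y k v ⟩
    y                    ∎

  *-cancel-≈0 : ∀ {x y} → ¬ (x ≈ 0#) → x * y ≈ 0# → y ≈ 0#
  *-cancel-≈0 {x} {y} x≉0 xy≈0 with (x⁻¹ , xx⁻¹≈1) ← inverse x x≉0 =
    -- Each `eliminate` uses one hypothesis together with its cofactor. The certificate here is y -
    -- 0 = x⁻¹ (x y - 0) - y (x x⁻¹ - 1); nested calls elsewhere are read in the same way.
    eliminate x⁻¹ xy≈0 (eliminate (- y) xx⁻¹≈1
      (solve 3 (λ x y i → y :+ i :* con (+ 0) :+ :- y :* con (+ 1)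
        := con (+ 0) :+ i :* (x :* y) :+ :- y :* (x :* i))
        refl x y x⁻¹))

  *-cancelˡ-≈ : ∀ {x y z} → ¬ (x ≈ 0#) → x * y ≈ x * z → y ≈ z
  *-cancelˡ-≈ {x} {y} {z} x≉0 eq = x∙y⁻¹≈ε⇒x≈y y z
    (*-cancel-≈0 x≉0 (trans (x[y-z]≈xy-xz x y z) (x≈y⇒x∙y⁻¹≈ε eq)))

  neg⇒pos : ∀ {x} → x < 0# → 0# < - x
  neg⇒pos {x} x<0 = <-respˡ-≈ (-‿inverseˡ x) (<-respʳ-≈ (+-identityʳ (- x)) (+-monoʳ-< (- x) x<0))

  diff-pos : ∀ {x y} → x < y → 0# < y - x
  diff-pos {x} {y} x<y = <-respˡ-≈ (-‿inverseˡ x) (<-respʳ-≈ (+-comm (- x) y) (+-monoʳ-< (- x) x<y))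

  diff-pos⁻¹ : ∀ {x y} → 0# < y - x → x < y
  diff-pos⁻¹ {x} {y} 0<y-x = <-respˡ-≈ (+-identityʳ x)
    (<-respʳ-≈ (solve 2 (λ x y → x :+ (y :- x) := y) refl x y) (+-monoʳ-< x 0<y-x))

  *-cancel-pos : ∀ {x y} → 0# < x → 0# < x * y → 0# < y
  *-cancel-pos {x} {y} 0<x 0<xy with compare 0# y
  ... | tri< 0<y _ _ = 0<y
  ... | tri≈ _ 0≈y _ = contradiction 0<xy (<-irrefl (sym (trans (*-congˡ (sym 0≈y)) (zeroʳ x))))
  ... | tri> _ _ y<0 = contradiction
    (<-trans 0<xy (diff-pos⁻¹ (<-respʳ-≈ (solve 2 (λ x y → x :* :- y := con (+ 0) :- x :* y) refl x y)
      (*-pos 0<x (neg⇒pos y<0)))))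
    (<-irrefl refl)

  square-pos : ∀ {x} → ¬ (x ≈ 0#) → 0# < x * x
  square-pos {x} x≉0 with compare 0# x
  ... | tri< 0<x _ _ = *-pos 0<x 0<x
  ... | tri≈ _ 0≈x _ = contradiction (sym 0≈x) x≉0
  ... | tri> _ _ x<0 = <-respʳ-≈ (solve 1 (λ x → :- x :* :- x := x :* x) refl x)
    (*-pos (neg⇒pos x<0) (neg⇒pos x<0))

  square-nonneg : ∀ x → 0# ≤ x * x
  square-nonneg x with x ≟ 0#
  ... | yes x≈0 = inj₂ (sym (trans (*-congˡ x≈0) (zeroʳ x)))
  ... | no  x≉0 = inj₁ (square-pos x≉0)

  pos+nonneg : ∀ {x y} → 0# < x → 0# ≤ y → 0# < x + y
  pos+nonneg 0<x (inj₁ 0<y) = <-trans 0<x (<-respˡ-≈ (+-identityʳ _) (+-monoʳ-< _ 0<y))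
  pos+nonneg 0<x (inj₂ 0≈y) = <-respʳ-≈ (trans (sym (+-identityʳ _)) (+-congˡ 0≈y)) 0<x

  nonneg+nonneg : ∀ {x y} → 0# ≤ x → 0# ≤ y → 0# ≤ x + y
  nonneg+nonneg (inj₁ 0<x) 0≤y = inj₁ (pos+nonneg 0<x 0≤y)
  nonneg+nonneg (inj₂ 0≈x) (inj₁ 0<y) = inj₁ (<-respʳ-≈ (trans (sym (+-identityˡ _)) (+-congʳ 0≈x)) 0<y)
  nonneg+nonneg (inj₂ 0≈x) (inj₂ 0≈y) = inj₂ (trans (sym (+-identityˡ 0#)) (+-cong 0≈x 0≈y))

  ‖‖²-nonneg : ∀ v → 0# ≤ ‖ v ‖²
  ‖‖²-nonneg ⟨ a , b , c ⟩ = nonneg+nonneg (nonneg+nonneg (square-nonneg a) (square-nonneg b)) (square-nonneg c)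

  first-summand≈0 : ∀ {x y} → 0# ≤ y → x * x + y ≈ 0# → x ≈ 0#
  first-summand≈0 {x} 0≤y sum≈0 with x ≟ 0#
  ... | yes x≈0 = x≈0
  ... | no  x≉0 = contradiction (pos+nonneg (square-pos x≉0) 0≤y) (<-irrefl (sym sum≈0))

  ‖‖²≈0 : ∀ a b c → ‖ ⟨ a , b , c ⟩ ‖² ≈ 0# → a ≈ 0# × b ≈ 0# × c ≈ 0#
  ‖‖²≈0 a b c eq =
    first-summand≈0 (nonneg+nonneg (square-nonneg b) (square-nonneg c)) (trans (sym (+-assoc _ _ _)) eq) ,
    first-summand≈0 (nonneg+nonneg (square-nonneg a) (square-nonneg c))
      (trans (solve 3 (λ a b c → b :+ (a :+ c) := a :+ b :+ c) refl (a * a) (b * b) (c * c)) eq) ,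
    first-summand≈0 (nonneg+nonneg (square-nonneg a) (square-nonneg b)) (trans (+-comm _ _) eq)

  num-injective : ∀ {i} → num i ≈ 0# → i ≡ + 0
  num-injective {+ zero}   _  = ≡.refl
  num-injective {+ suc n}  eq = contradiction (num-pos n) (<-irrefl (sym eq))
  num-injective { -[1+ n ]} eq = contradiction (num-pos n)
    (<-irrefl (sym (trans (sym (-‿involutive _)) (trans (-‿cong eq) -0#≈0#))))

  fromℤ-+ : ∀ i j → fromℤ (i ℤ.+ j) ≈ fromℤ i + fromℤ j
  fromℤ-+ i j = trans (fromℤ≈num (i ℤ.+ j))
    (trans (num-+ i j) (sym (+-cong (fromℤ≈num i) (fromℤ≈num j))))
    where open Numerals

  fromℤ-* : ∀ i j → fromℤ (i ℤ.* j) ≈ fromℤ i * fromℤ j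
  fromℤ-* i j = trans (fromℤ≈num (i ℤ.* j))
    (trans (num-* i j) (sym (*-cong (fromℤ≈num i) (fromℤ≈num j))))
    where open Numerals

  fromℤ-neg : ∀ i → fromℤ (ℤ.- i) ≈ - fromℤ i
  fromℤ-neg i = trans (fromℤ≈num (ℤ.- i)) (trans (num-neg i) (-‿cong (sym (fromℤ≈num i))))
    where open Numerals

  fromℤ-injective : ∀ {i j} → fromℤ i ≈ fromℤ j → i ≡ j
  fromℤ-injective {i} {j} eq = ℤ.i-j≡0⇒i≡j i j (num-injective
    (trans (sym (Numerals.fromℤ≈num (i ℤ.- j)))
      (trans (fromℤ-+ i (ℤ.- j)) (trans (+-cong eq (fromℤ-neg j)) (-‿inverseʳ _)))))

-- Lorentzian ℝ⁵ and its null vectors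

module Lorentz (ℛ : CompleteOrderedField) where
  open Geometry ℛ
  open CompleteOrderedField ℛ renaming (Carrier to ℝ)
  open IsStrictTotalOrder isStrictTotalOrder
    using (_≟_)
  open OrderedField ℛ
  open SetoidReasoning setoid

  -- Inversive coordinates. For an oriented round sphere, `b` is the bend, `b̄` the bend of its
  -- image under inversion in the unit sphere at the origin, and `m` is the bend times the centre.
  record ℝ⁵ : Set where
    constructor ⟨_∣_∣_⟩
    field
      b  : ℝ
      b̄  : ℝ
      m  : ℝ³

  infix  8 _•_
  infixl 6 _⊞_
  infixr 7 _⊡_

  -- Twice the Lorentz product, so that no halves occur: a sphere has square 2.
  _•_ : ℝ⁵ → ℝ⁵ → ℝ
  ⟨ b ∣ b̄ ∣ m ⟩ • ⟨ b′ ∣ b̄′ ∣ m′ ⟩ = 2# * (m · m′) - (b * b̄′ + b̄ * b′)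

  _⊞_ : ℝ⁵ → ℝ⁵ → ℝ⁵
  ⟨ b ∣ b̄ ∣ m ⟩ ⊞ ⟨ b′ ∣ b̄′ ∣ m′ ⟩ = ⟨ b + b′ ∣ b̄ + b̄′ ∣ m ⊕ m′ ⟩

  _⊡_ : ℝ → ℝ⁵ → ℝ⁵
  k ⊡ ⟨ b ∣ b̄ ∣ m ⟩ = ⟨ k * b ∣ k * b̄ ∣ k ⊛ m ⟩

  ·-comm : ∀ u v → u · v ≈ v · u
  ·-comm ⟨ a , b , c ⟩ ⟨ a′ , b′ , c′ ⟩ = +-cong (+-cong (*-comm a a′) (*-comm b b′)) (*-comm c c′)

  ·-⊛ʳ : ∀ u k v → u · (k ⊛ v) ≈ k * (u · v)
  ·-⊛ʳ ⟨ a , b , c ⟩ k ⟨ a′ , b′ , c′ ⟩ =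
    solve 7 (λ a b c a′ b′ c′ k →
      a :* (k :* a′) :+ b :* (k :* b′) :+ c :* (k :* c′) := k :* (a :* a′ :+ b :* b′ :+ c :* c′))
      refl a b c a′ b′ c′ k

  ·-⊖ʳ : ∀ u v w → u · (v ⊖ w) ≈ u · v - u · w
  ·-⊖ʳ ⟨ a , b , c ⟩ ⟨ a′ , b′ , c′ ⟩ ⟨ a″ , b″ , c″ ⟩ =
    solve 9 (λ a b c a′ b′ c′ a″ b″ c″ →
      a :* (a′ :- a″) :+ b :* (b′ :- b″) :+ c :* (c′ :- c″)
      := (a :* a′ :+ b :* b′ :+ c :* c′) :- (a :* a″ :+ b :* b″ :+ c :* c″))
      refl a b c a′ b′ c′ a″ b″ c″

  ·-⊕ʳ : ∀ u v w → u · (v ⊕ w) ≈ u · v + u · w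
  ·-⊕ʳ ⟨ a , b , c ⟩ ⟨ a′ , b′ , c′ ⟩ ⟨ a″ , b″ , c″ ⟩ =
    solve 9 (λ a b c a′ b′ c′ a″ b″ c″ →
      a :* (a′ :+ a″) :+ b :* (b′ :+ b″) :+ c :* (c′ :+ c″)
      := (a :* a′ :+ b :* b′ :+ c :* c′) :+ (a :* a″ :+ b :* b″ :+ c :* c″))
      refl a b c a′ b′ c′ a″ b″ c″

  ‖⊖‖² : ∀ u v → ‖ u ⊖ v ‖² ≈ ‖ u ‖² - 2# * (u · v) + ‖ v ‖²
  ‖⊖‖² ⟨ a , b , c ⟩ ⟨ a′ , b′ , c′ ⟩ =
    solve 6 (λ a b c a′ b′ c′ →
      (a :- a′) :* (a :- a′) :+ (b :- b′) :* (b :- b′) :+ (c :- c′) :* (c :- c′)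
      := (a :* a :+ b :* b :+ c :* c) :- con (+ 2) :* (a :* a′ :+ b :* b′ :+ c :* c′)
         :+ (a′ :* a′ :+ b′ :* b′ :+ c′ :* c′))
      refl a b c a′ b′ c′

  ‖⊕‖² : ∀ u v → ‖ u ⊕ v ‖² ≈ ‖ u ‖² + 2# * (u · v) + ‖ v ‖²
  ‖⊕‖² ⟨ a , b , c ⟩ ⟨ a′ , b′ , c′ ⟩ =
    solve 6 (λ a b c a′ b′ c′ →
      (a :+ a′) :* (a :+ a′) :+ (b :+ b′) :* (b :+ b′) :+ (c :+ c′) :* (c :+ c′)
      := (a :* a :+ b :* b :+ c :* c) :+ con (+ 2) :* (a :* a′ :+ b :* b′ :+ c :* c′)
         :+ (a′ :* a′ :+ b′ :* b′ :+ c′ :* c′))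
      refl a b c a′ b′ c′

  ‖⊛‖² : ∀ k v → ‖ k ⊛ v ‖² ≈ k * k * ‖ v ‖²
  ‖⊛‖² k ⟨ a , b , c ⟩ =
    solve 4 (λ k a b c → k :* a :* (k :* a) :+ k :* b :* (k :* b) :+ k :* c :* (k :* c)
      := k :* k :* (a :* a :+ b :* b :+ c :* c)) refl k a b c

  •-comm : ∀ x y → x • y ≈ y • x
  •-comm ⟨ b ∣ b̄ ∣ m ⟩ ⟨ b′ ∣ b̄′ ∣ m′ ⟩ =
    +-cong (*-congˡ (·-comm m m′))
           (-‿cong (trans (+-comm _ _) (+-cong (*-comm b̄ b′) (*-comm b b̄′))))

  •-⊞ʳ : ∀ x y z → x • (y ⊞ z) ≈ x • y + x • z
  •-⊞ʳ ⟨ b ∣ b̄ ∣ m ⟩ ⟨ b′ ∣ b̄′ ∣ m′ ⟩ ⟨ b″ ∣ b̄″ ∣ m″ ⟩ =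
    eliminate 2# (·-⊕ʳ m m′ m″)
      (solve 9 (λ b b̄ b′ b̄′ b″ b̄″ s s′ s″ →
        con (+ 2) :* s :- (b :* (b̄′ :+ b̄″) :+ b̄ :* (b′ :+ b″)) :+ con (+ 2) :* (s′ :+ s″)
        := (con (+ 2) :* s′ :- (b :* b̄′ :+ b̄ :* b′)) :+ (con (+ 2) :* s″ :- (b :* b̄″ :+ b̄ :* b″))
           :+ con (+ 2) :* s)
        refl b b̄ b′ b̄′ b″ b̄″ (m · (m′ ⊕ m″)) (m · m′) (m · m″))

  •-⊡ʳ : ∀ x k y → x • (k ⊡ y) ≈ k * (x • y)
  •-⊡ʳ ⟨ b ∣ b̄ ∣ m ⟩ k ⟨ b′ ∣ b̄′ ∣ m′ ⟩ =
    eliminate 2# (·-⊛ʳ m k m′)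
      (solve 7 (λ b b̄ b′ b̄′ k s s′ →
        con (+ 2) :* s :- (b :* (k :* b̄′) :+ b̄ :* (k :* b′)) :+ con (+ 2) :* (k :* s′)
        := k :* (con (+ 2) :* s′ :- (b :* b̄′ :+ b̄ :* b′)) :+ con (+ 2) :* s)
        refl b b̄ b′ b̄′ k (m · (k ⊛ m′)) (m · m′))

  •-combinationʳ : ∀ x k y l z → x • (k ⊡ y ⊞ l ⊡ z) ≈ k * (x • y) + l * (x • z)
  •-combinationʳ x k y l z = trans (•-⊞ʳ x (k ⊡ y) (l ⊡ z)) (+-cong (•-⊡ʳ x k y) (•-⊡ʳ x l z))

  •-combinationˡ : ∀ k y l z x → (k ⊡ y ⊞ l ⊡ z) • x ≈ k * (y • x) + l * (z • x)
  •-combinationˡ k y l z x = trans (•-comm _ x)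
    (trans (•-combinationʳ x k y l z) (+-cong (*-congˡ (•-comm x y)) (*-congˡ (•-comm x z))))

  •-combination² : ∀ k y l z →
    (k ⊡ y ⊞ l ⊡ z) • (k ⊡ y ⊞ l ⊡ z) ≈ k * k * (y • y) + 2# * (k * l) * (y • z) + l * l * (z • z)
  •-combination² k y l z = begin
    (k ⊡ y ⊞ l ⊡ z) • (k ⊡ y ⊞ l ⊡ z)
      ≈⟨ •-combinationˡ k y l z _ ⟩
    k * (y • (k ⊡ y ⊞ l ⊡ z)) + l * (z • (k ⊡ y ⊞ l ⊡ z))
      ≈⟨ +-cong (*-congˡ (•-combinationʳ y k y l z)) (*-congˡ (•-combinationʳ z k y l z)) ⟩
    k * (k * (y • y) + l * (y • z)) + l * (k * (z • y) + l * (z • z))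
      ≈⟨ +-congˡ (*-congˡ (+-congʳ (*-congˡ (•-comm z y)))) ⟩
    k * (k * (y • y) + l * (y • z)) + l * (k * (y • z) + l * (z • z))
      ≈⟨ solve 5 (λ k l yy yz zz →
           k :* (k :* yy :+ l :* yz) :+ l :* (k :* yz :+ l :* zz)
           := k :* k :* yy :+ con (+ 2) :* (k :* l) :* yz :+ l :* l :* zz)
           refl k l (y • y) (y • z) (z • z) ⟩
    k * k * (y • y) + 2# * (k * l) * (y • z) + l * l * (z • z) ∎

  -- For `t • t ≈ 2#` this is the orthogonal reflection in the hyperplane of vectors orthogonal to
  -- `t`. The summand `1# ⊡ x` makes it an instance of the lemmas on combinations of two vectors.
  reflection : ℝ⁵ → ℝ⁵ → ℝ⁵
  reflection t x = 1# ⊡ x ⊞ (- (x • t)) ⊡ t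

  reflection-• : ∀ t x y → reflection t x • y ≈ x • y - (x • t) * (t • y)
  reflection-• t x y = trans (•-combinationˡ 1# x (- (x • t)) t y)
    (solve 3 (λ u v w → con (+ 1) :* u :+ :- v :* w := u :- v :* w) refl (x • y) (x • t) (t • y))

  reflection-isometry : ∀ t → t • t ≈ 2# → ∀ x y → reflection t x • reflection t y ≈ x • y
  reflection-isometry t t•t≈2 x y = begin
    reflection t x • reflection t y
      ≈⟨ reflection-• t x _ ⟩
    x • reflection t y - (x • t) * (t • reflection t y)
      ≈⟨ +-cong (trans (•-comm x _) (reflection-• t y x))
                (-‿cong (*-congˡ (trans (•-comm t _) (reflection-• t y t)))) ⟩
    y • x - (y • t) * (t • x) - (x • t) * (y • t - (y • t) * (t • t))
      ≈⟨ +-cong (+-cong (•-comm y x) (-‿cong (*-congˡ (•-comm t x))))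
                (-‿cong (*-congˡ (+-congˡ (-‿cong (*-congˡ t•t≈2))))) ⟩
    x • y - (y • t) * (x • t) - (x • t) * (y • t - (y • t) * 2#)
      ≈⟨ solve 3 (λ xy xt yt → xy :- yt :* xt :- xt :* (yt :- yt :* con (+ 2)) := xy)
           refl (x • y) (x • t) (y • t) ⟩
    x • y ∎

  -- The usual lift to the light cone. The value at `∞` is the limit of `point (fin p)` divided by
  -- ‖p‖² as p tends to infinity.
  point : ℝ̂³ → ℝ⁵
  point (fin p) = ⟨ 1# ∣ ‖ p ‖² ∣ p ⟩
  point ∞       = ⟨ 0# ∣ 1# ∣ ⟨ 0# , 0# , 0# ⟩ ⟩

  •-∞ : ∀ x → x • point ∞ ≈ - ℝ⁵.b x
  •-∞ ⟨ b ∣ b̄ ∣ ⟨ x , y , z ⟩ ⟩ =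
    solve 5 (λ b b̄ x y z →
      con (+ 2) :* (x :* con (+ 0) :+ y :* con (+ 0) :+ z :* con (+ 0)) :- (b :* con (+ 1) :+ b̄ :* con (+ 0))
      := :- b) refl b b̄ x y z

  point-null : ∀ p → point p • point p ≈ 0#
  point-null (fin p) = solve 1 (λ s → con (+ 2) :* s :- (con (+ 1) :* s :+ s :* con (+ 1)) := con (+ 0))
                         refl ‖ p ‖²
  point-null ∞       = trans (•-∞ (point ∞)) (solve 0 (:- con (+ 0) := con (+ 0)) refl)

  point-•-fin : ∀ p q → point (fin p) • point (fin q) ≈ - ‖ p ⊖ q ‖²
  point-•-fin p q = eliminate 1# (‖⊖‖² p q)
    (solve 4 (λ pp pq qq s → con (+ 2) :* pq :- (con (+ 1) :* qq :+ pp :* con (+ 1))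
               :+ con (+ 1) :* (pp :- con (+ 2) :* pq :+ qq) := :- s :+ con (+ 1) :* s)
      refl ‖ p ‖² (p · q) ‖ q ‖² ‖ p ⊖ q ‖²)

  x-y≈0⇒x≈y : ∀ {x y} → x - y ≈ 0# → x ≈ y
  x-y≈0⇒x≈y {x} {y} eq = eliminate 1# eq
    (solve 2 (λ x y → x :+ con (+ 1) :* con (+ 0) := y :+ con (+ 1) :* (x :- y)) refl x y)

  -x≈0⇒x≈0 : ∀ {x} → - x ≈ 0# → x ≈ 0#
  -x≈0⇒x≈0 {x} eq = eliminate (- 1#) eq
    (solve 1 (λ x → x :+ :- con (+ 1) :* con (+ 0) := con (+ 0) :+ :- con (+ 1) :* :- x) refl x)

  ‖⊖‖²≈0 : ∀ p q → ‖ p ⊖ q ‖² ≈ 0# → fin p ≋ fin q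
  ‖⊖‖²≈0 ⟨ a , b , c ⟩ ⟨ a′ , b′ , c′ ⟩ eq
    with (a≈ , b≈ , c≈) ← ‖‖²≈0 (a - a′) (b - b′) (c - c′) eq =
    x-y≈0⇒x≈y a≈ , x-y≈0⇒x≈y b≈ , x-y≈0⇒x≈y c≈

  -- The pairing is minus the squared distance of two finite points, and -1 if exactly one of the
  -- points is `∞`.
  point-separates : ∀ p q → point p • point q ≈ 0# → p ≋ q
  point-separates (fin p) (fin q) eq = ‖⊖‖²≈0 p q (-x≈0⇒x≈0 (trans (sym (point-•-fin p q)) eq))
  point-separates (fin p) ∞ eq = ⊥-elim (pos⇒≉0 0<1 (-x≈0⇒x≈0 (trans (sym (•-∞ (point (fin p)))) eq)))
  point-separates ∞ (fin q) eq =
    ⊥-elim (pos⇒≉0 0<1 (-x≈0⇒x≈0 (trans (sym (•-∞ (point (fin q)))) (trans (•-comm _ (point ∞)) eq))))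
  point-separates ∞ ∞ _ = tt

  ‖‖²≈0⇒·≈0 : ∀ u v → ‖ u ‖² ≈ 0# → u · v ≈ 0#
  ‖‖²≈0⇒·≈0 ⟨ a , b , c ⟩ ⟨ a′ , b′ , c′ ⟩ eq with (a≈0 , b≈0 , c≈0) ← ‖‖²≈0 a b c eq =
    trans (+-cong (+-cong (*-congʳ a≈0) (*-congʳ b≈0)) (*-congʳ c≈0))
      (solve 3 (λ a b c → con (+ 0) :* a :+ con (+ 0) :* b :+ con (+ 0) :* c := con (+ 0)) refl a′ b′ c′)

  -- If b is nonzero, the point is m / b with factor b. Otherwise nullity says ‖m‖² = 0, so only b̄
  -- survives and the point is `∞`. The factor κ may vanish, namely for the zero vector.
  null⇒point : ∀ x → x • x ≈ 0# → ∃ λ p → ∃ λ κ → ∀ y → x • y ≈ κ * (point p • y)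
  null⇒point ⟨ b ∣ b̄ ∣ m ⟩ null with b ≟ 0#
  ... | no b≉0 = fin (b⁻¹ ⊛ m) , b , identity-at
    where
    b⁻¹ = proj₁ (inverse b b≉0)
    b*b⁻¹≈1 = proj₂ (inverse b b≉0)
    ‖m‖²≈bb̄ : ‖ m ‖² ≈ b * b̄
    ‖m‖²≈bb̄ = *-cancelˡ-≈ (pos⇒≉0 0<2) (eliminate 1# null
      (solve 3 (λ b b̄ s → con (+ 2) :* s :+ con (+ 1) :* con (+ 0)
                 := con (+ 2) :* (b :* b̄) :+ con (+ 1) :* (con (+ 2) :* s :- (b :* b̄ :+ b̄ :* b)))
        refl b b̄ ‖ m ‖²))
    ‖b⁻¹m‖² : ‖ b⁻¹ ⊛ m ‖² ≈ b⁻¹ * b̄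
    ‖b⁻¹m‖² = trans (‖⊛‖² b⁻¹ m) (trans (*-congˡ ‖m‖²≈bb̄) (eliminate (b⁻¹ * b̄) b*b⁻¹≈1
      (solve 3 (λ b b̄ i → i :* i :* (b :* b̄) :+ i :* b̄ :* con (+ 1) := i :* b̄ :+ i :* b̄ :* (b :* i))
        refl b b̄ b⁻¹)))
    identity-at : ∀ y → ⟨ b ∣ b̄ ∣ m ⟩ • y ≈ b * (point (fin (b⁻¹ ⊛ m)) • y)
    identity-at ⟨ b′ ∣ b̄′ ∣ m′ ⟩ =
      eliminate (b * b′) ‖b⁻¹m‖²
        (eliminate (- (2# * b)) (trans (·-comm _ m′) (trans (·-⊛ʳ m′ b⁻¹ m) (*-congˡ (·-comm m′ m))))
        (eliminate (b̄ * b′ - 2# * m·m′) b*b⁻¹≈1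
        (solve 8 (λ b b̄ b′ b̄′ i s s′ n →
           con (+ 2) :* s :- (b :* b̄′ :+ b̄ :* b′) :+ b :* b′ :* (i :* b̄)
             :+ :- (con (+ 2) :* b) :* (i :* s) :+ (b̄ :* b′ :- con (+ 2) :* s) :* con (+ 1)
           := b :* (con (+ 2) :* s′ :- (con (+ 1) :* b̄′ :+ n :* b′)) :+ b :* b′ :* n
             :+ :- (con (+ 2) :* b) :* s′ :+ (b̄ :* b′ :- con (+ 2) :* s) :* (b :* i))
           refl b b̄ b′ b̄′ b⁻¹ m·m′ ((b⁻¹ ⊛ m) · m′) ‖ b⁻¹ ⊛ m ‖²)))
      where m·m′ = m · m′
  null⇒point ⟨ b ∣ b̄ ∣ m ⟩ null | yes b≈0 = ∞ , b̄ , identity-at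
    where
    ‖m‖²≈0 : ‖ m ‖² ≈ 0#
    ‖m‖²≈0 = *-cancel-≈0 (pos⇒≉0 0<2) (eliminate 1# null (eliminate (2# * b̄) b≈0
      (solve 3 (λ b b̄ s → con (+ 2) :* s :+ con (+ 1) :* con (+ 0) :+ con (+ 2) :* b̄ :* con (+ 0)
                 := con (+ 0) :+ con (+ 1) :* (con (+ 2) :* s :- (b :* b̄ :+ b̄ :* b)) :+ con (+ 2) :* b̄ :* b)
        refl b b̄ ‖ m ‖²)))
    identity-at : ∀ y → ⟨ b ∣ b̄ ∣ m ⟩ • y ≈ b̄ * (point ∞ • y)
    identity-at y@(⟨ b′ ∣ b̄′ ∣ m′ ⟩) =
      eliminate (- b̄′) b≈0 (eliminate 2# (‖‖²≈0⇒·≈0 m m′ ‖m‖²≈0)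
        (eliminate (- b̄) (trans (•-comm (point ∞) y) (•-∞ y))
        (solve 6 (λ b b̄ b′ b̄′ s t →
          con (+ 2) :* s :- (b :* b̄′ :+ b̄ :* b′) :+ :- b̄′ :* con (+ 0) :+ con (+ 2) :* con (+ 0)
            :+ :- b̄ :* :- b′
          := b̄ :* t :+ :- b̄′ :* b :+ con (+ 2) :* s :+ :- b̄ :* t)
          refl b b̄ b′ b̄′ (m · m′) (point ∞ • y))))

-- Vectors of oriented spheres

module Coordinates (ℛ : CompleteOrderedField) where
  open Geometry ℛ
  open CompleteOrderedField ℛ renaming (Carrier to ℝ)
  open IsStrictTotalOrder isStrictTotalOrder
    using (_≟_; <-respˡ-≈; <-respʳ-≈)
    renaming (trans to <-trans)
  open OrderedField ℛ
  open Lorentz ℛ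
  open SetoidReasoning setoid

  -- The positive factor by which the pairing with a point exceeds `height`; for a round sphere it
  -- is 1/r.
  scale : Sphere → ℝ
  scale (round c r 0<r) = proj₁ (inverse r (pos⇒≉0 0<r))
  scale (plane n d _)   = 2#

  -- For the negative side: (b , b (‖c‖² − r²) , b c) with b = 1/r.  The plane is
  -- the limit of such spheres as b tends to 0.
  coordinates : Sphere → ℝ⁵
  coordinates T@(round c r 0<r) = ⟨ scale T ∣ scale T * (‖ c ‖² - r * r) ∣ scale T ⊛ c ⟩
  coordinates (plane n d _) = ⟨ 0# ∣ - (2# * d) ∣ (- 1#) ⊛ n ⟩

  sign : Side → ℝ
  sign negative = 1#
  sign positive = - 1#

  orientedCoordinates : OrientedSphere → ℝ⁵
  orientedCoordinates (orient T side) = sign side ⊡ coordinates T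

  -- Zero on the surface and positive on the `negative` component, so that `sign` times `height` is
  -- positive on the region. The values at `∞` are those that make `coordinates-point` hold there.
  height : Sphere → ℝ̂³ → ℝ
  height (round c r _) (fin v) = r * r - ‖ v ⊖ c ‖²
  height (round c r _) ∞       = - 1#
  height (plane n d _) (fin v) = d - n · v
  height (plane n d _) ∞       = 0#

  scale-pos : ∀ T → 0# < scale T
  scale-pos (round c r 0<r) = inverse-pos 0<r (proj₂ (inverse r (pos⇒≉0 0<r)))
  scale-pos (plane n d _)   = 0<2

  radius*scale≈1 : ∀ c r (0<r : 0# < r) → r * scale (round c r 0<r) ≈ 1#
  radius*scale≈1 c r 0<r = proj₂ (inverse r (pos⇒≉0 0<r))

  ⊛-·ˡ : ∀ k u v → (k ⊛ u) · v ≈ k * (u · v)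
  ⊛-·ˡ k u v = trans (·-comm (k ⊛ u) v) (trans (·-⊛ʳ v k u) (*-congˡ (·-comm v u)))

  coordinates-point : ∀ T p → coordinates T • point p ≈ scale T * height T p
  coordinates-point T@(round c r 0<r) (fin v) =
    eliminate 2# (⊛-·ˡ ρ c v) (eliminate ρ (‖⊖‖² v c) (eliminate (- (2# * ρ)) (·-comm v c)
      (solve 8 (λ ρ r cc vv cv s q t →
        con (+ 2) :* s :- (ρ :* vv :+ ρ :* (cc :- r :* r) :* con (+ 1)) :+ con (+ 2) :* (ρ :* cv)
          :+ ρ :* (vv :- con (+ 2) :* t :+ cc) :+ :- (con (+ 2) :* ρ) :* cv
        := ρ :* (r :* r :- q) :+ con (+ 2) :* s :+ ρ :* q :+ :- (con (+ 2) :* ρ) :* t)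
        refl ρ r ‖ c ‖² ‖ v ‖² (c · v) ((ρ ⊛ c) · v) ‖ v ⊖ c ‖² (v · c))))
    where ρ = scale T
  coordinates-point T@(round c r 0<r) ∞ = trans (•-∞ (coordinates T))
    (solve 1 (λ ρ → :- ρ := ρ :* :- con (+ 1)) refl (scale T))
  coordinates-point (plane n d _) (fin v) =
    eliminate 2# (⊛-·ˡ (- 1#) n v)
      (solve 4 (λ d vv nv s →
        con (+ 2) :* s :- (con (+ 0) :* vv :+ :- (con (+ 2) :* d) :* con (+ 1))
          :+ con (+ 2) :* (:- con (+ 1) :* nv)
        := con (+ 2) :* (d :- nv) :+ con (+ 2) :* s)
        refl d ‖ v ‖² (n · v) (((- 1#) ⊛ n) · v))
  coordinates-point T@(plane n d _) ∞ = trans (•-∞ (coordinates T))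
    (solve 0 (:- con (+ 0) := con (+ 2) :* con (+ 0)) refl)

  coordinates-unit : ∀ T → coordinates T • coordinates T ≈ 2#
  coordinates-unit T@(round c r 0<r) =
    eliminate 2# (‖⊛‖² ρ c) (eliminate (2# * (r * ρ + 1#)) (radius*scale≈1 c r 0<r)
      (solve 4 (λ ρ r cc s →
        con (+ 2) :* s :- (ρ :* (ρ :* (cc :- r :* r)) :+ ρ :* (cc :- r :* r) :* ρ)
          :+ con (+ 2) :* (ρ :* ρ :* cc) :+ con (+ 2) :* (r :* ρ :+ con (+ 1)) :* con (+ 1)
        := con (+ 2) :+ con (+ 2) :* s :+ con (+ 2) :* (r :* ρ :+ con (+ 1)) :* (r :* ρ))
        refl ρ r ‖ c ‖² ‖ ρ ⊛ c ‖²))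
    where ρ = scale T
  coordinates-unit (plane n d ‖n‖²≈1) =
    eliminate 2# (trans (‖⊛‖² (- 1#) n) (*-congˡ ‖n‖²≈1))
      (solve 2 (λ d s →
        con (+ 2) :* s :- (con (+ 0) :* :- (con (+ 2) :* d) :+ :- (con (+ 2) :* d) :* con (+ 0))
          :+ con (+ 2) :* (:- con (+ 1) :* :- con (+ 1) :* con (+ 1))
        := con (+ 2) :+ con (+ 2) :* s)
        refl d ‖ (- 1#) ⊛ n ‖²)

  ⊡-•ˡ : ∀ k x y → (k ⊡ x) • y ≈ k * (x • y)
  ⊡-•ˡ k x y = trans (•-comm _ y) (trans (•-⊡ʳ y k x) (*-congˡ (•-comm y x)))

  orientedCoordinates-unit : ∀ S → orientedCoordinates S • orientedCoordinates S ≈ 2#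
  orientedCoordinates-unit (orient T side) = trans (⊡-•ˡ k v _) (trans (*-congˡ (•-⊡ʳ v k v))
    (trans (*-congˡ (*-congˡ (coordinates-unit T))) (sign²*2 side)))
    where
    k = sign side
    v = coordinates T
    sign²*2 : ∀ side → sign side * (sign side * 2#) ≈ 2#
    sign²*2 negative = solve 0 (con (+ 1) :* (con (+ 1) :* con (+ 2)) := con (+ 2)) refl
    sign²*2 positive = solve 0 (:- con (+ 1) :* (:- con (+ 1) :* con (+ 2)) := con (+ 2)) refl

  bend-coordinates : ∀ S → bend S ≈ - (orientedCoordinates S • point ∞)
  bend-coordinates S = trans (sym (-‿involutive _))
    (-‿cong (sym (trans (•-∞ (orientedCoordinates S)) (-‿cong (first-coordinate S)))))
    where
    open RingProperties ring using (-‿involutive)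
    first-coordinate : ∀ S → ℝ⁵.b (orientedCoordinates S) ≈ bend S
    first-coordinate (orient (round _ _ _) negative) = *-identityˡ _
    first-coordinate (orient (round _ _ _) positive) = -1*x≈-x _
      where open RingProperties ring using (-1*x≈-x)
    first-coordinate (orient (plane _ _ _) side) = zeroʳ (sign side)

  surface⇒height≈0 : ∀ T p → p ∈ surface T → height T p ≈ 0#
  surface⇒height≈0 (round c r _) (fin v) eq = trans (+-congˡ (-‿cong eq)) (-‿inverseʳ _)
  surface⇒height≈0 (plane n d _) (fin v) eq = trans (+-congˡ (-‿cong eq)) (-‿inverseʳ _)
  surface⇒height≈0 (plane n d _) ∞       _  = refl

  height≈0⇒surface : ∀ T p → height T p ≈ 0# → p ∈ surface T
  height≈0⇒surface (round c r _) (fin v) eq = sym (x-y≈0⇒x≈y eq)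
  height≈0⇒surface (round c r _) ∞       eq = pos⇒≉0 0<1 (-x≈0⇒x≈0 eq)
  height≈0⇒surface (plane n d _) (fin v) eq = sym (x-y≈0⇒x≈y eq)
  height≈0⇒surface (plane n d _) ∞       _  = tt

  surface⇒•≈0 : ∀ S p → p ∈ surface (sphere S) → orientedCoordinates S • point p ≈ 0#
  surface⇒•≈0 (orient T side) p p∈T = trans (⊡-•ˡ (sign side) (coordinates T) (point p))
    (trans (*-congˡ (trans (coordinates-point T p)
      (trans (*-congˡ (surface⇒height≈0 T p p∈T)) (zeroʳ _)))) (zeroʳ _))

  sign≉0 : ∀ side → ¬ (sign side ≈ 0#)
  sign≉0 negative = pos⇒≉0 0<1
  sign≉0 positive = pos⇒≉0 0<1 ∘ -x≈0⇒x≈0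

  •≈0⇒surface : ∀ S p → orientedCoordinates S • point p ≈ 0# → p ∈ surface (sphere S)
  •≈0⇒surface (orient T side) p eq = height≈0⇒surface T p
    (*-cancel-≈0 (pos⇒≉0 (scale-pos T)) (trans (sym (coordinates-point T p))
      (*-cancel-≈0 (sign≉0 side) (trans (sym (⊡-•ˡ (sign side) (coordinates T) (point p))) eq))))

  region⇒signed-height-pos : ∀ S p → p ∈ region S → 0# < sign (side S) * height (sphere S) p
  region⇒signed-height-pos (orient (round c r _) negative) (fin v) lt = <-respʳ-≈ (sym (*-identityˡ _))
    (diff-pos lt)
  region⇒signed-height-pos (orient (round c r _) positive) (fin v) lt = <-respʳ-≈
    (solve 2 (λ x y → x :- y := :- con (+ 1) :* (y :- x)) refl ‖ v ⊖ c ‖² (r * r)) (diff-pos lt)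
  region⇒signed-height-pos (orient (round c r _) positive) ∞ _ = <-respʳ-≈
    (solve 0 (con (+ 1) := :- con (+ 1) :* :- con (+ 1)) refl) 0<1
  region⇒signed-height-pos (orient (plane n d _) negative) (fin v) lt = <-respʳ-≈ (sym (*-identityˡ _))
    (diff-pos lt)
  region⇒signed-height-pos (orient (plane n d _) positive) (fin v) lt = <-respʳ-≈
    (solve 2 (λ x y → x :- y := :- con (+ 1) :* (y :- x)) refl (n · v) d) (diff-pos lt)

  region⇒•-pos : ∀ S p → p ∈ region S → 0# < orientedCoordinates S • point p
  region⇒•-pos S@(orient T side) p p∈S = <-respʳ-≈
    (begin
      scale T * (sign side * height T p)        ≈⟨ solve 3 (λ a b c → a :* (b :* c) := b :* (a :* c)) refl _ _ _ ⟩
      sign side * (scale T * height T p)        ≈⟨ *-congˡ (coordinates-point T p) ⟨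
      sign side * (coordinates T • point p)     ≈⟨ ⊡-•ˡ (sign side) (coordinates T) (point p) ⟨
      orientedCoordinates S • point p           ∎)
    (*-pos (scale-pos T) (region⇒signed-height-pos S p p∈S))

  -- Two opposite poles, or `∞` and the foot of the normal through the origin. A vector that happens
  -- to be orthogonal to the first point is moved off it in `perp` by adding the second.
  two-surface-points : ∀ T → ∃ λ p → ∃ λ q → p ∈ surface T × q ∈ surface T × ¬ (point p • point q ≈ 0#)
  two-surface-points (round c@(⟨ x , y , z ⟩) r 0<r) =
    fin ⟨ x , y , z + r ⟩ , fin ⟨ x , y , z - r ⟩ ,
    solve 4 (λ x y z r → (x :- x) :* (x :- x) :+ (y :- y) :* (y :- y) :+ (z :+ r :- z) :* (z :+ r :- z) := r :* r)
      refl x y z r ,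
    solve 4 (λ x y z r → (x :- x) :* (x :- x) :+ (y :- y) :* (y :- y) :+ (z :- r :- z) :* (z :- r :- z) := r :* r)
      refl x y z r ,
    λ eq → contradiction (point-separates (fin ⟨ x , y , z + r ⟩) (fin ⟨ x , y , z - r ⟩) eq)
      λ (_ , _ , z+r≈z-r) → pos⇒≉0 0<r (*-cancel-≈0 (pos⇒≉0 0<2) (eliminate 1# z+r≈z-r
        (solve 2 (λ z r → con (+ 2) :* r :+ con (+ 1) :* (z :- r)
          := con (+ 0) :+ con (+ 1) :* (z :+ r)) refl z r)))
  two-surface-points (plane n d ‖n‖²≈1) =
    ∞ , fin (d ⊛ n) , tt , trans (·-⊛ʳ n d n) (trans (*-congˡ ‖n‖²≈1) (*-identityʳ d)) ,
    point-separates ∞ (fin (d ⊛ n))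

  region-point : ∀ S → ∃ λ p → p ∈ region S
  region-point (orient (round c r 0<r) negative) = fin c ,
    <-respˡ-≈ (sym (trans (‖⊖‖² c c) (solve 1 (λ s → s :- con (+ 2) :* s :+ s := con (+ 0)) refl ‖ c ‖²)))
      (*-pos 0<r 0<r)
  region-point (orient (round c r 0<r) positive) = ∞ , tt
  region-point (orient (plane n d ‖n‖²≈1) negative) = fin ((d - 1#) ⊛ n) ,
    diff-pos⁻¹ (<-respʳ-≈ (eliminate 1# (trans (·-⊛ʳ n (d - 1#) n) (*-congˡ ‖n‖²≈1))
      (solve 2 (λ d s → con (+ 1) :+ con (+ 1) :* ((d :- con (+ 1)) :* con (+ 1)) := d :- s :+ con (+ 1) :* s)
        refl d _)) 0<1)
  region-point (orient (plane n d ‖n‖²≈1) positive) = fin ((d + 1#) ⊛ n) ,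
    diff-pos⁻¹ (<-respʳ-≈ (eliminate (- 1#) (trans (·-⊛ʳ n (d + 1#) n) (*-congˡ ‖n‖²≈1))
      (solve 2 (λ d s → con (+ 1) :+ :- con (+ 1) :* ((d :+ con (+ 1)) :* con (+ 1))
        := s :- d :+ :- con (+ 1) :* s)
        refl d _)) 0<1)

  -- The surface and the region determine the vector

  module Uniqueness
    (S : OrientedSphere) (w : ℝ⁵) (w•w≈2 : w • w ≈ 2#)
    (surface⊆ : ∀ p → p ∈ surface (sphere S) → w • point p ≈ 0#)
    (region⊆ : ∀ p → p ∈ region S → 0# < w • point p)
    where

    v : ℝ⁵
    v = orientedCoordinates S

    -- A null vector is a multiple of a point, and a point orthogonal to `v` lies on the surface,
    -- where `w` vanishes.
    null-perp : ∀ x → x • x ≈ 0# → v • x ≈ 0# → w • x ≈ 0#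
    null-perp x null v•x≈0 with (p , κ , x•) ← null⇒point x null with κ ≟ 0#
    ... | yes κ≈0 = trans (•-comm w x) (trans (x• w) (trans (*-congʳ κ≈0) (zeroˡ _)))
    ... | no  κ≉0 = trans (•-comm w x) (trans (x• w) (trans (*-congˡ (trans (•-comm (point p) w) p⊥w)) (zeroʳ κ)))
      where
      p⊥v : v • point p ≈ 0#
      p⊥v = trans (•-comm v (point p)) (*-cancel-≈0 κ≉0 (trans (sym (x• v)) (trans (•-comm x v) v•x≈0)))
      p⊥w : w • point p ≈ 0#
      p⊥w = surface⊆ p (•≈0⇒surface S p p⊥v)

    -- If p is a null vector orthogonal to v with y • p ≠ 0, then y is a
    -- combination of p and of another null vector orthogonal to v.
    perp-generic : ∀ p y → p • p ≈ 0# → v • p ≈ 0# → ¬ (y • p ≈ 0#) → v • y ≈ 0# → w • y ≈ 0#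
    perp-generic p y null v•p≈0 y•p≉0 v•y≈0 = *-cancel-≈0 y•p≉0 (*-cancel-≈0 (pos⇒≉0 0<2)
      (begin
        2# * (y • p * (w • y))
          ≈⟨ eliminate (y • y) (null-perp p null v•p≈0)
               (solve 4 (λ g u s Y → con (+ 2) :* (g :* u) :+ Y :* con (+ 0)
                  := con (+ 2) :* g :* u :+ :- Y :* s :+ Y :* s) refl (y • p) (w • y) (w • p) (y • y)) ⟩
        2# * (y • p) * (w • y) + (- (y • y)) * (w • p)
          ≈⟨ •-combinationʳ w _ y _ p ⟨
        w • x
          ≈⟨ null-perp x x-null v•x≈0 ⟩
        0# ∎))
      where
      x : ℝ⁵
      x = (2# * (y • p)) ⊡ y ⊞ (- (y • y)) ⊡ p
      x-null : x • x ≈ 0#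
      x-null = trans (•-combination² _ y _ p) (eliminate (y • y * (y • y)) null
        (solve 3 (λ g Y P → con (+ 2) :* g :* (con (+ 2) :* g) :* Y :+ con (+ 2) :* (con (+ 2) :* g :* :- Y) :* g
            :+ :- Y :* :- Y :* P :+ Y :* Y :* con (+ 0) := con (+ 0) :+ Y :* Y :* P)
          refl (y • p) (y • y) (p • p)))
      v•x≈0 : v • x ≈ 0#
      v•x≈0 = trans (•-combinationʳ v _ y _ p) (trans (+-cong (*-congˡ v•y≈0) (*-congˡ v•p≈0))
        (solve 2 (λ a b → a :* con (+ 0) :+ b :* con (+ 0) := con (+ 0)) refl _ _))

    perp : ∀ y → v • y ≈ 0# → w • y ≈ 0#
    perp y v•y≈0 with (p , q , p∈S , q∈S , p•q≉0) ← two-surface-points (sphere S) with y • point p ≟ 0#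
    ... | no  y•p≉0 = perp-generic (point p) y (point-null p) (surface⇒•≈0 S p p∈S) y•p≉0 v•y≈0
    -- Here `y` is replaced by `y ⊞ point q`, whose pairing with `p` is the nonzero number p • q; as
    -- `w` vanishes at `q`, the result for the sum gives the one for `y`.
    ... | yes y•p≈0 = eliminate (- 1#) (surface⊆ q q∈S)
      (begin
        w • y + - 1# * 0#         ≈⟨ solve 1 (λ y → y :+ :- con (+ 1) :* con (+ 0) := y) refl (w • y) ⟩
        w • y                     ≈⟨ solve 2 (λ y q → y
          := y :+ q :+ :- con (+ 1) :* q) refl (w • y) (w • point q) ⟩
        w • y + w • point q + - 1# * (w • point q)   ≈⟨ +-congʳ (•-⊞ʳ w y (point q)) ⟨
        w • (y ⊞ point q) + - 1# * (w • point q)     ≈⟨ +-congʳ y+q⊥w ⟩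
        0# + - 1# * (w • point q) ∎)
      where
      y+q•p : (y ⊞ point q) • point p ≈ point p • point q
      y+q•p = trans (•-comm _ (point p)) (trans (•-⊞ʳ (point p) y (point q))
        (trans (+-congʳ (trans (•-comm (point p) y) y•p≈0)) (+-identityˡ _)))
      y+q⊥w : w • (y ⊞ point q) ≈ 0#
      y+q⊥w = perp-generic (point p) (y ⊞ point q) (point-null p) (surface⇒•≈0 S p p∈S)
        (λ eq → p•q≉0 (trans (sym y+q•p) eq))
        (trans (•-⊞ʳ v y (point q)) (trans (+-cong v•y≈0 (surface⇒•≈0 S q q∈S)) (+-identityˡ 0#)))

    -- Because `v • v ≈ 2#`, the vector 2 y - (v • y) v is orthogonal to `v`, and by `perp` to `w`.
    proportional : ∀ y → 2# * (w • y) ≈ (v • y) * (w • v)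
    proportional y = x-y≈0⇒x≈y (begin
      2# * (w • y) - (v • y) * (w • v)        ≈⟨ solve 3 (λ a b c → a :- b :* c := a :+ :- b :* c) refl _ _ _ ⟩
      2# * (w • y) + (- (v • y)) * (w • v)    ≈⟨ •-combinationʳ w 2# y _ v ⟨
      w • (2# ⊡ y ⊞ (- (v • y)) ⊡ v)          ≈⟨ perp _ (trans (•-combinationʳ v 2# y _ v)
                                                  (trans (+-congˡ (*-congˡ (orientedCoordinates-unit S)))
                                                  (solve 1 (λ a → con (+ 2) :* a :+ :- a :* con (+ 2)
                                                    := con (+ 0)) refl _))) ⟩
      0# ∎)

    w•v-pos : 0# < w • v
    w•v-pos with (p , p∈S) ← region-point S = *-cancel-pos (region⇒•-pos S p p∈S)
      (<-respʳ-≈ (proportional (point p)) (*-pos 0<2 (region⊆ p p∈S)))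

    -- Applied to `w`, proportionality gives (w • v)² = 2 (w • w) = 4. The region excludes the root
    -- -2, which belongs to the opposite orientation.
    w•v≈2 : w • v ≈ 2#
    w•v≈2 = x-y≈0⇒x≈y (*-cancel-≈0 (pos⇒≉0 (<-trans w•v-pos
      (<-respˡ-≈ (+-identityʳ _) (+-monoʳ-< (w • v) 0<2)))) (begin
      (w • v + 2#) * (w • v - 2#)             ≈⟨ solve 1 (λ s → (s :+ con (+ 2)) :* (s :- con (+ 2))
                                                              := s :* s :- con (+ 2) :* con (+ 2)) refl (w • v) ⟩
      (w • v) * (w • v) - 2# * 2#             ≈⟨ +-cong (*-congʳ (•-comm w v)) (-‿cong (*-congˡ (sym w•w≈2))) ⟩
      (v • w) * (w • v) - 2# * (w • w)        ≈⟨ +-congʳ (proportional w) ⟨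
      2# * (w • w) - 2# * (w • w)             ≈⟨ -‿inverseʳ _ ⟩
      0# ∎))

    unique : ∀ y → w • y ≈ v • y
    unique y = *-cancelˡ-≈ (pos⇒≉0 0<2) (trans (proportional y) (trans (*-congˡ w•v≈2) (*-comm _ _)))

-- Inversions as Lorentzian reflections

module Inversions (ℛ : CompleteOrderedField) where
  open Geometry ℛ
  open CompleteOrderedField ℛ renaming (Carrier to ℝ)
  open IsStrictTotalOrder isStrictTotalOrder
    using (_≟_; <-respʳ-≈)
  open OrderedField ℛ
  open Lorentz ℛ
  open Coordinates ℛ
  open SetoidReasoning setoid

  reflection-point : ∀ T x p →
    reflection (coordinates T) x • point p ≈ x • point p - (x • coordinates T) * (scale T * height T p)
  reflection-point T x p = trans (reflection-• (coordinates T) x (point p))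
    (+-congˡ (-‿cong (*-congˡ (coordinates-point T p))))

  •-round : ∀ b b̄ m c r (0<r : 0# < r) → let T = round c r 0<r in
    ⟨ b ∣ b̄ ∣ m ⟩ • coordinates T ≈ scale T * (2# * (m · c) - b * (‖ c ‖² - r * r) - b̄)
  •-round b b̄ m c r 0<r = eliminate 2# (·-⊛ʳ m ρ c)
    (solve 7 (λ b b̄ r cc ρ s t →
      con (+ 2) :* s :- (b :* (ρ :* (cc :- r :* r)) :+ b̄ :* ρ) :+ con (+ 2) :* (ρ :* t)
      := ρ :* (con (+ 2) :* t :- b :* (cc :- r :* r) :- b̄) :+ con (+ 2) :* s)
      refl b b̄ r ‖ c ‖² ρ (m · (ρ ⊛ c)) (m · c))
    where ρ = scale (round c r 0<r)

  •-plane : ∀ b b̄ m n d (‖n‖²≈1 : ‖ n ‖² ≈ 1#) →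
    ⟨ b ∣ b̄ ∣ m ⟩ • coordinates (plane n d ‖n‖²≈1) ≈ 2# * (b * d - m · n)
  •-plane b b̄ m n d _ = eliminate 2# (·-⊛ʳ m (- 1#) n)
    (solve 5 (λ b b̄ d s t →
      con (+ 2) :* s :- (b :* :- (con (+ 2) :* d) :+ b̄ :* con (+ 0)) :+ con (+ 2) :* (:- con (+ 1) :* t)
      := con (+ 2) :* (b :* d :- t) :+ con (+ 2) :* s)
      refl b b̄ d (m · ((- 1#) ⊛ n)) (m · n))

  -- On null vectors an inversion is the reflection up to the factor κ; the reflection is
  -- self-adjoint and is moved to `x`. The factor is r²/‖v - c‖² in general, 1/r² at the centre, r²
  -- at `∞`, and 1 for planes. Its positivity is what lets sides be followed, and its independence
  -- of `x` what makes the identity one of vectors.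
  inversion-point : ∀ T p → ∃ λ κ → 0# < κ ×
    (∀ x → x • point (inversion T p) ≈ κ * (reflection (coordinates T) x • point p))
  inversion-point T@(round c r 0<r) (fin v) with ‖ v ⊖ c ‖² ≟ 0#
  ... | yes q≈0 = ρ * ρ , *-pos (scale-pos T) (scale-pos T) , λ x@(⟨ b ∣ b̄ ∣ m ⟩) →
    trans (•-∞ x) (sym (trans (*-congˡ (trans (reflection-point T x (fin v))
      (+-congˡ (-‿cong (*-congʳ (•-round b b̄ m c r 0<r))))))
      (centre-identity b b̄ m)))
    where
    ρ = scale T
    v≈c : ∀ u → u · (v ⊖ c) ≈ 0#
    v≈c u = trans (·-comm u (v ⊖ c)) (‖‖²≈0⇒·≈0 (v ⊖ c) u q≈0)
    u·v≈u·c : ∀ u → u · v ≈ u · c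
    u·v≈u·c u = x-y≈0⇒x≈y (trans (sym (·-⊖ʳ u v c)) (v≈c u))
    ‖v‖²≈‖c‖² : ‖ v ‖² ≈ ‖ c ‖²
    ‖v‖²≈‖c‖² = trans (u·v≈u·c v) (trans (·-comm v c) (u·v≈u·c c))
    centre-identity : ∀ b b̄ m →
      ρ * ρ * (2# * (m · v) - (b * ‖ v ‖² + b̄ * 1#)
        - ρ * (2# * (m · c) - b * (‖ c ‖² - r * r) - b̄) * (ρ * (r * r - ‖ v ⊖ c ‖²))) ≈ - b
    centre-identity b b̄ m = eliminate (ρ * ρ * (ρ * ρ) * Y) q≈0
      (eliminate (2# * ρ * ρ) (u·v≈u·c m) (eliminate (- (ρ * ρ * b)) ‖v‖²≈‖c‖²
      (eliminate (- (ρ * ρ * Y * (r * ρ + 1#)) - b * (r * ρ + 1#)) (radius*scale≈1 c r 0<r)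
      (solve 9 (λ b b̄ r ρ cc vv mv mc q →
         let Y = con (+ 2) :* mc :- b :* (cc :- r :* r) :- b̄ in
         ρ :* ρ :* (con (+ 2) :* mv :- (b :* vv :+ b̄ :* con (+ 1)) :- ρ :* Y :* (ρ :* (r :* r :- q)))
           :+ ρ :* ρ :* (ρ :* ρ) :* Y :* con (+ 0)
           :+ con (+ 2) :* ρ :* ρ :* mc
           :+ :- (ρ :* ρ :* b) :* cc
           :+ (:- (ρ :* ρ :* Y :* (r :* ρ :+ con (+ 1))) :- b :* (r :* ρ :+ con (+ 1))) :* con (+ 1)
         := :- b
           :+ ρ :* ρ :* (ρ :* ρ) :* Y :* q
           :+ con (+ 2) :* ρ :* ρ :* mv
           :+ :- (ρ :* ρ :* b) :* vv
           :+ (:- (ρ :* ρ :* Y :* (r :* ρ :+ con (+ 1))) :- b :* (r :* ρ :+ con (+ 1))) :* (r :* ρ))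
        refl b b̄ r ρ ‖ c ‖² ‖ v ‖² (m · v) (m · c) ‖ v ⊖ c ‖²))))
      where Y = 2# * (m · c) - b * (‖ c ‖² - r * r) - b̄
  ... | no q≉0 = k , k-pos , λ x@(⟨ b ∣ b̄ ∣ m ⟩) →
    begin
      x • point (fin (c ⊕ k ⊛ (v ⊖ c)))
        ≈⟨ +-cong (*-congˡ (m·image m)) (-‿cong (+-congʳ (*-congˡ ‖image‖²))) ⟩
      2# * (m · c + k * (m · v - m · c)) - (b * (‖ c ‖² + 2# * (k * (c · v - ‖ c ‖²)) + k * k * q) + b̄ * 1#)
        ≈⟨ inversion-identity b b̄ m ⟩
      k * (x • point (fin v) - ρ * (2# * (m · c) - b * (‖ c ‖² - r * r) - b̄) * (ρ * (r * r - q)))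
        ≈⟨ *-congˡ (trans (reflection-point T x (fin v)) (+-congˡ (-‿cong (*-congʳ (•-round b b̄ m c r 0<r))))) ⟨
      k * (reflection (coordinates T) x • point (fin v)) ∎
    where
    ρ = scale T
    q = ‖ v ⊖ c ‖²
    q⁻¹ = proj₁ (inverse q q≉0)
    k = r * r * q⁻¹
    0<q : 0# < q
    0<q with ‖‖²-nonneg (v ⊖ c)
    ... | inj₁ lt = lt
    ... | inj₂ 0≈q = contradiction (sym 0≈q) q≉0
    k-pos : 0# < k
    k-pos = *-pos (*-pos 0<r 0<r) (inverse-pos 0<q (proj₂ (inverse q q≉0)))
    kq≈r² : k * q ≈ r * r
    kq≈r² = eliminate (r * r) (proj₂ (inverse q q≉0))
      (solve 3 (λ r i q → r :* r :* i :* q :+ r :* r :* con (+ 1) := r :* r :+ r :* r :* (q :* i)) refl r q⁻¹ q)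
    m·image : ∀ m → m · (c ⊕ k ⊛ (v ⊖ c)) ≈ m · c + k * (m · v - m · c)
    m·image m = trans (·-⊕ʳ m c (k ⊛ (v ⊖ c)))
      (+-congˡ (trans (·-⊛ʳ m k (v ⊖ c)) (*-congˡ (·-⊖ʳ m v c))))
    ‖image‖² : ‖ c ⊕ k ⊛ (v ⊖ c) ‖² ≈ ‖ c ‖² + 2# * (k * (c · v - ‖ c ‖²)) + k * k * q
    ‖image‖² = trans (‖⊕‖² c (k ⊛ (v ⊖ c))) (+-cong
      (+-congˡ (*-congˡ (trans (·-⊛ʳ c k (v ⊖ c)) (*-congˡ (·-⊖ʳ c v c))))) (‖⊛‖² k (v ⊖ c)))
    inversion-identity : ∀ b b̄ m →
      2# * (m · c + k * (m · v - m · c)) - (b * (‖ c ‖² + 2# * (k * (c · v - ‖ c ‖²)) + k * k * q) + b̄ * 1#)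
      ≈ k * (2# * (m · v) - (b * ‖ v ‖² + b̄ * 1#)
             - ρ * (2# * (m · c) - b * (‖ c ‖² - r * r) - b̄) * (ρ * (r * r - q)))
    inversion-identity b b̄ m = eliminate Y scaled
      (eliminate (b * (1# - k)) kq≈r²
      (eliminate (- (b * k)) (trans (‖⊖‖² v c) (+-congʳ (+-congˡ (-‿cong (*-congˡ (·-comm v c))))))
      (solve 11 (λ b b̄ r ρ k cc vv cv mv mc q →
         let Y = con (+ 2) :* mc :- b :* (cc :- r :* r) :- b̄ in
         con (+ 2) :* (mc :+ k :* (mv :- mc))
           :- (b :* (cc :+ con (+ 2) :* (k :* (cv :- cc)) :+ k :* k :* q) :+ b̄ :* con (+ 1))
           :+ Y :* (k :- con (+ 1))
           :+ b :* (con (+ 1) :- k) :* (r :* r)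
           :+ :- (b :* k) :* (vv :- con (+ 2) :* cv :+ cc)
         := k :* (con (+ 2) :* mv :- (b :* vv :+ b̄ :* con (+ 1)) :- ρ :* Y :* (ρ :* (r :* r :- q)))
           :+ Y :* (k :* (ρ :* ρ :* (r :* r :- q)))
           :+ b :* (con (+ 1) :- k) :* (k :* q)
           :+ :- (b :* k) :* q)
        refl b b̄ r ρ k ‖ c ‖² ‖ v ‖² (c · v) (m · v) (m · c) q)))
      where
      Y = 2# * (m · c) - b * (‖ c ‖² - r * r) - b̄
      -- This follows from k q = r² and ρ r = 1. The left side is, up to sign, the coefficient of
      -- `Y` in the reflected pairing, where `Y` is the pairing of `x` with `coordinates T` freed of
      -- its factor ρ.
      scaled : k * (ρ * ρ * (r * r - q)) ≈ k - 1#
      scaled = eliminate (- (ρ * ρ)) kq≈r² (eliminate ((k - 1#) * (r * ρ + 1#)) (radius*scale≈1 c r 0<r)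
        (solve 4 (λ k ρ r q →
           k :* (ρ :* ρ :* (r :* r :- q)) :+ :- (ρ :* ρ) :* (r :* r)
             :+ (k :- con (+ 1)) :* (r :* ρ :+ con (+ 1)) :* con (+ 1)
           := k :- con (+ 1) :+ :- (ρ :* ρ) :* (k :* q) :+ (k :- con (+ 1)) :* (r :* ρ :+ con (+ 1)) :* (r :* ρ))
          refl k ρ r q))
  inversion-point T@(round c r 0<r) ∞ = r * r , *-pos 0<r 0<r , λ x@(⟨ b ∣ b̄ ∣ m ⟩) →
    begin
      2# * (m · c) - (b * ‖ c ‖² + b̄ * 1#)
        ≈⟨ eliminate (- (Y b b̄ m * (r * ρ + 1#))) (radius*scale≈1 c r 0<r)
             (solve 6 (λ b b̄ r ρ cc mc →
               let Y = con (+ 2) :* mc :- b :* (cc :- r :* r) :- b̄ in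
               con (+ 2) :* mc :- (b :* cc :+ b̄ :* con (+ 1)) :+ :- (Y :* (r :* ρ :+ con (+ 1))) :* con (+ 1)
               := r :* r :* (:- b :- ρ :* Y :* (ρ :* :- con (+ 1)))
                 :+ :- (Y :* (r :* ρ :+ con (+ 1))) :* (r :* ρ))
               refl b b̄ r ρ ‖ c ‖² (m · c)) ⟩
      r * r * (- b - ρ * Y b b̄ m * (ρ * - 1#))
        ≈⟨ *-congˡ (trans (reflection-point T x ∞)
             (+-cong (•-∞ x) (-‿cong (*-congʳ (•-round b b̄ m c r 0<r))))) ⟨
      r * r * (reflection (coordinates T) x • point ∞) ∎
    where
    ρ = scale T
    Y : ℝ → ℝ → ℝ³ → ℝ
    Y b b̄ m = 2# * (m · c) - b * (‖ c ‖² - r * r) - b̄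
  inversion-point T@(plane n d ‖n‖²≈1) (fin v) = 1# , 0<1 , λ x@(⟨ b ∣ b̄ ∣ m ⟩) →
    begin
      x • point (fin (v ⊖ s ⊛ n))
        ≈⟨ +-cong (*-congˡ (trans (·-⊖ʳ m v (s ⊛ n)) (+-congˡ (-‿cong (·-⊛ʳ m s n)))))
                  (-‿cong (+-congʳ (*-congˡ ‖image‖²))) ⟩
      2# * (m · v - s * (m · n)) - (b * (‖ v ‖² - 2# * (s * (n · v)) + s * s * 1#) + b̄ * 1#)
        ≈⟨ solve 7 (λ b b̄ d vv nv mv mn →
             let s = con (+ 2) :* (nv :- d) in
             con (+ 2) :* (mv :- s :* mn)
               :- (b :* (vv :- con (+ 2) :* (s :* nv) :+ s :* s :* con (+ 1)) :+ b̄ :* con (+ 1))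
             := con (+ 1) :* (con (+ 2) :* mv :- (b :* vv :+ b̄ :* con (+ 1))
                :- con (+ 2) :* (b :* d :- mn) :* (con (+ 2) :* (d :- nv))))
             refl b b̄ d ‖ v ‖² (n · v) (m · v) (m · n) ⟩
      1# * (x • point (fin v) - 2# * (b * d - m · n) * (2# * (d - n · v)))
        ≈⟨ *-congˡ (trans (reflection-point T x (fin v)) (+-congˡ (-‿cong (*-congʳ (•-plane b b̄ m n d ‖n‖²≈1)))))
          ⟨
      1# * (reflection (coordinates T) x • point (fin v)) ∎
    where
    s = 2# * (n · v - d)
    ‖image‖² : ‖ v ⊖ s ⊛ n ‖² ≈ ‖ v ‖² - 2# * (s * (n · v)) + s * s * 1#
    ‖image‖² = trans (‖⊖‖² v (s ⊛ n)) (+-cong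
      (+-congˡ (-‿cong (*-congˡ (trans (·-⊛ʳ v s n) (*-congˡ (·-comm v n))))))
      (trans (‖⊛‖² s n) (*-congˡ ‖n‖²≈1)))
  inversion-point T@(plane n d ‖n‖²≈1) ∞ = 1# , 0<1 , λ x →
    trans (solve 2 (λ u w → u := con (+ 1) :* (u :- w :* (con (+ 2) :* con (+ 0)))) refl (x • point ∞)
      (x • coordinates T))
      (sym (*-congˡ (reflection-point T x ∞)))

  -- The adjoint of the action on points: the outermost inversion is applied to the vector first.
  -- Working against the direction of φ avoids constructing its inverse.
  pullback : ∀ {φ} → IsMöbius φ → ℝ⁵ → ℝ⁵
  pullback identity     x = x
  pullback (invert T μ) x = pullback μ (reflection (coordinates T) x)

  pullback-isometry : ∀ {φ} (μ : IsMöbius φ) x y → pullback μ x • pullback μ y ≈ x • y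
  pullback-isometry identity     x y = refl
  pullback-isometry (invert T μ) x y =
    trans (pullback-isometry μ _ _) (reflection-isometry (coordinates T) (coordinates-unit T) x y)

  pullback-point : ∀ {φ} (μ : IsMöbius φ) p → ∃ λ κ → 0# < κ ×
    (∀ x → x • point (φ p) ≈ κ * (pullback μ x • point p))
  pullback-point identity p = 1# , 0<1 , λ x → sym (*-identityˡ _)
  pullback-point (invert {φ} T μ) p
    with (κ , 0<κ , h) ← inversion-point T (φ p) | (κ′ , 0<κ′ , h′) ← pullback-point μ p =
    κ * κ′ , *-pos 0<κ 0<κ′ , λ x → trans (h x) (trans (*-congˡ (h′ _)) (sym (*-assoc _ _ _)))

  ≋-refl : ∀ p → p ≋ p
  ≋-refl (fin ⟨ _ , _ , _ ⟩) = refl , refl , refl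
  ≋-refl ∞ = tt

  -- As φ carries the surface and the region of `S` into those of `S′`, the pulled-back vector
  -- vanishes on the surface and is positive on the region of `S`; it also has square 2, so
  -- uniqueness applies.
  pullback-MapsTo : ∀ {φ} (μ : IsMöbius φ) {S S′} → MapsTo φ S S′ →
    ∀ y → pullback μ (orientedCoordinates S′) • y ≈ orientedCoordinates S • y
  pullback-MapsTo {φ} μ {S} {S′} ((surface⊆ , _) , (region⊆ , _)) = Uniqueness.unique S (pullback μ v′)
    (trans (pullback-isometry μ v′ v′) (orientedCoordinates-unit S′))
    (λ p p∈S → let (κ , 0<κ , h) = pullback-point μ p in
      *-cancel-≈0 (pos⇒≉0 0<κ) (trans (sym (h v′))
        (surface⇒•≈0 S′ (φ p) (surface⊆ (p , p∈S , ≋-refl (φ p))))))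
    (λ p p∈S → let (κ , 0<κ , h) = pullback-point μ p in
      *-cancel-pos 0<κ (<-respʳ-≈ (h v′)
        (region⇒•-pos S′ (φ p) (region⊆ (p , p∈S , ≋-refl (φ p))))))
    where v′ = orientedCoordinates S′

  -- Equal surfaces and regions force equal vectors, whatever the parameters, and the bend is the
  -- pairing with `∞` up to sign.
  ≅⇒bend≈ : ∀ {S S′} → S ≅ S′ → bend S ≈ bend S′
  ≅⇒bend≈ {S} {S′} ((surface⊆ , _) , (region⊆ , _)) =
    trans (bend-coordinates S) (trans (-‿cong (sym (Uniqueness.unique S (orientedCoordinates S′)
      (orientedCoordinates-unit S′)
      (λ p p∈S → surface⇒•≈0 S′ p (surface⊆ p∈S))
      (λ p p∈S → region⇒•-pos S′ p (region⊆ p∈S)) (point ∞)))) (sym (bend-coordinates S′)))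

  -- Minus half the Euclidean gradient at `p` of the function v ↦ `x • point (fin v)`, hence normal
  -- to its zero set.
  gradient : ℝ⁵ → ℝ³ → ℝ³
  gradient ⟨ b ∣ b̄ ∣ m ⟩ p = b ⊛ p ⊖ m

  -- At a common zero the two incidence equations express b̄ and b̄′ by the other coordinates, which
  -- turns the Lorentz pairing into a Euclidean product of normals.
  gradient-· : ∀ x y p → x • point (fin p) ≈ 0# → y • point (fin p) ≈ 0# →
    2# * (gradient x p · gradient y p) ≈ x • y
  gradient-· ⟨ b ∣ b̄ ∣ m ⟩ ⟨ b′ ∣ b̄′ ∣ m′ ⟩ p x⊥p y⊥p =
    eliminate (- b) y⊥p (eliminate (- b′) x⊥p
      (trans (+-congʳ (+-congʳ (*-congˡ expand)))
      (solve 8 (λ b b̄ b′ b̄′ pp mp m′p mm →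
        con (+ 2) :* (b :* b′ :* pp :- b :* m′p :- b′ :* mp :+ mm) :+ :- b :* con (+ 0) :+ :- b′ :* con (+ 0)
        := con (+ 2) :* mm :- (b :* b̄′ :+ b̄ :* b′)
          :+ :- b :* (con (+ 2) :* m′p :- (b′ :* pp :+ b̄′ :* con (+ 1)))
          :+ :- b′ :* (con (+ 2) :* mp :- (b :* pp :+ b̄ :* con (+ 1))))
        refl b b̄ b′ b̄′ ‖ p ‖² (m · p) (m′ · p) (m · m′))))
    where
    expand : (b ⊛ p ⊖ m) · (b′ ⊛ p ⊖ m′) ≈ b * b′ * ‖ p ‖² - b * (m′ · p) - b′ * (m · p) + m · m′
    expand = begin
      (b ⊛ p ⊖ m) · (b′ ⊛ p ⊖ m′)
        ≈⟨ trans (·-⊖ʳ _ (b′ ⊛ p) m′) (+-cong (trans (·-⊛ʳ _ b′ p) (*-congˡ (·-comm _ p))) (-‿cong (·-comm _ m′)))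
          ⟩
      b′ * (p · (b ⊛ p ⊖ m)) - m′ · (b ⊛ p ⊖ m)
        ≈⟨ +-cong (*-congˡ (trans (·-⊖ʳ p (b ⊛ p) m) (+-cong (·-⊛ʳ p b p) (-‿cong (·-comm p m)))))
                  (-‿cong (trans (·-⊖ʳ m′ (b ⊛ p) m) (+-cong (·-⊛ʳ m′ b p) (-‿cong (·-comm m′ m))))) ⟩
      b′ * (b * ‖ p ‖² - m · p) - (b * (m′ · p) - m · m′)
        ≈⟨ solve 6 (λ b b′ pp mp m′p mm → b′ :* (b :* pp :- mp) :- (b :* m′p :- mm)
             := b :* b′ :* pp :- b :* m′p :- b′ :* mp :+ mm) refl b b′ ‖ p ‖² (m · p) (m′ · p) (m · m′) ⟩
      b * b′ * ‖ p ‖² - b * (m′ · p) - b′ * (m · p) + m · m′ ∎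

  gradient-normal : ∀ T p → ∃ λ σ → ∀ u → u · gradient (coordinates T) p ≈ σ * (u · normal T p)
  gradient-normal T@(round c r 0<r) p = scale T , λ u →
    trans (·-⊖ʳ u _ _) (trans (+-cong (·-⊛ʳ u _ p) (-‿cong (·-⊛ʳ u _ c)))
      (trans (sym (x[y-z]≈xy-xz (scale T) (u · p) (u · c))) (*-congˡ (sym (·-⊖ʳ u p c)))))
    where open RingProperties ring using (x[y-z]≈xy-xz)
  gradient-normal (plane n d _) p = 1# , λ u →
    trans (·-⊖ʳ u _ _) (trans (+-cong (·-⊛ʳ u _ p) (-‿cong (·-⊛ʳ u _ n)))
      (solve 2 (λ s t → con (+ 0) :* s :- :- con (+ 1) :* t := con (+ 1) :* t) refl (u · p) (u · n)))

  Orthogonal⇒•≈0 : ∀ S T → Orthogonal S T → coordinates S • coordinates T ≈ 0#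
  Orthogonal⇒•≈0 S T ((p , p∈S , p∈T) , orthogonal)
    with (σ , h) ← gradient-normal S p | (τ , h′) ← gradient-normal T p = begin
      coordinates S • coordinates T
        ≈⟨ gradient-· (coordinates S) (coordinates T) p (on S p∈S) (on T p∈T) ⟨
      2# * (gradient (coordinates S) p · gradient (coordinates T) p)
        ≈⟨ *-congˡ (trans (h′ _) (*-congˡ (trans (·-comm _ (normal T p)) (trans (h (normal T p))
             (*-congˡ (trans (·-comm (normal T p) (normal S p)) (orthogonal p (p∈S , p∈T)))))))) ⟩
      2# * (τ * (σ * 0#))
        ≈⟨ solve 2 (λ τ σ → con (+ 2) :* (τ :* (σ :* con (+ 0))) := con (+ 0)) refl τ σ ⟩
      0# ∎
    where
    on : ∀ U → fin p ∈ surface U → coordinates U • point (fin p) ≈ 0#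
    on U p∈U = trans (coordinates-point U (fin p)) (trans (*-congˡ (surface⇒height≈0 U (fin p) p∈U)) (zeroʳ _))

  -- A vector orthogonal to a point is never timelike: its square is twice the squared length of its
  -- gradient there, or of `m` when the point is `∞`. This is what makes antipodal spheres disjoint.
  orthogonal-to-point⇒nonneg : ∀ x p → x • point p ≈ 0# → 0# ≤ x • x
  orthogonal-to-point⇒nonneg x (fin p) x⊥p = ≤-respʳ (gradient-· x x p x⊥p x⊥p) (double-nonneg (‖‖²-nonneg _))
    where
    ≤-respʳ : ∀ {a b c} → b ≈ c → a ≤ b → a ≤ c
    ≤-respʳ b≈c = Sum.map (<-respʳ-≈ b≈c) (λ eq → trans eq b≈c)
    double-nonneg : ∀ {a} → 0# ≤ a → 0# ≤ 2# * a
    double-nonneg {a} 0≤a = ≤-respʳ (solve 1 (λ a → a :+ a := con (+ 2) :* a) refl a) (nonneg+nonneg 0≤a 0≤a)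
  orthogonal-to-point⇒nonneg x@(⟨ b ∣ b̄ ∣ m ⟩) ∞ x⊥p =
    Sum.map (<-respʳ-≈ eq) (λ h → trans h eq) (nonneg+nonneg (‖‖²-nonneg m) (‖‖²-nonneg m))
    where
    eq : ‖ m ‖² + ‖ m ‖² ≈ x • x
    eq = eliminate (2# * b̄) (-x≈0⇒x≈0 (trans (sym (•-∞ x)) x⊥p))
      (solve 3 (λ b b̄ s → s :+ s :+ con (+ 2) :* b̄ :* con (+ 0)
        := con (+ 2) :* s :- (b :* b̄ :+ b̄ :* b) :+ con (+ 2) :* b̄ :* b)
        refl b b̄ ‖ m ‖²)

-- The Gram matrix and the antipodal classes

-- The value -2 is that of tangent spheres with disjoint regions; -6 is that of an antipodal pair
-- such as the plane S₁ and the ball S₅.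
gramEntry : Fin 8 → Fin 8 → ℤ
gramEntry i j with i Fin.≟ j | sameClass? i j
... | yes _ | _     = + 2
... | no _  | yes _ = -[1+ 5 ]
... | no _  | no _  = -[1+ 1 ]

gramEntry-antipodal : ∀ {i j} → i ≢ j → SameClass i j → gramEntry i j ≡ -[1+ 5 ]
gramEntry-antipodal {i} {j} i≢j same with i Fin.≟ j | sameClass? i j
... | yes i≡j | _         = contradiction i≡j i≢j
... | no _    | yes _     = ≡.refl
... | no _    | no ¬same  = contradiction same ¬same

gramEntry-tangent : ∀ {i j} → ¬ SameClass i j → gramEntry i j ≡ -[1+ 1 ]
gramEntry-tangent {i} {j} ¬same with i Fin.≟ j | sameClass? i j
... | yes ≡.refl | _        = contradiction ≡.refl ¬same
... | no _       | yes same = contradiction same ¬same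
... | no _       | no _     = ≡.refl

-- The sum is 2 - 6 within a class and -2 - 2 across classes. It shows in `frame⇒Tangent` that the
-- sum of two of the vectors is not zero.
gramEntry-total : ∀ i → gramEntry i 0F ℤ.+ gramEntry i 4F ≡ -[1+ 3 ]
gramEntry-total = toWitness {a? = all? λ i → gramEntry i 0F ℤ.+ gramEntry i 4F ℤ.≟ -[1+ 3 ]} _

class : Fin 8 → Fin 4
class k = toℕ k mod 4

class≡⇒SameClass : ∀ {k l} → class k ≡ class l → SameClass k l
class≡⇒SameClass {k} {l} eq = ≡.trans (≡.sym (toℕ-fromℕ< (m%n<n (toℕ k) 4)))
  (≡.trans (≡.cong toℕ eq) (toℕ-fromℕ< (m%n<n (toℕ l) 4)))

class-members : ∀ k → k ≡ class k ↑ˡ 4 ⊎ k ≡ 4 ↑ʳ class k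
class-members = toWitness
  {a? = all? λ k → (k Fin.≟ class k ↑ˡ 4) ⊎-dec (k Fin.≟ 4 ↑ʳ class k)} _

-- Pigeonhole: punching out a missed value would inject a set of n + 1 elements into one of n.
injective⇒surjective : ∀ {n} (f : Fin n → Fin n) → Injective _≡_ _≡_ f → ∀ y → ∃ λ x → f x ≡ y
injective⇒surjective {ℕ.suc n} f f-injective y with any? (λ x → f x Fin.≟ y)
... | yes hit = hit
... | no miss = contradiction (injective⇒≤ {f = λ x → punchOut (y≢f x)}
  (λ {x} {x′} eq → f-injective (punchOut-injective (y≢f x) (y≢f x′) eq))) ℕ.1+n≰n
  where
  y≢f : ∀ x → y ≢ f x
  y≢f x y≡fx = miss (x , ≡.sym y≡fx)

-- Frames: configurations seen through their pairings

module Frames (ℛ : CompleteOrderedField) where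
  open Geometry ℛ
  open CompleteOrderedField ℛ renaming (Carrier to ℝ)
  open IsStrictTotalOrder isStrictTotalOrder
    using (<-respʳ-≈)
    renaming (irrefl to <-irrefl)
  open OrderedField ℛ
  open Lorentz ℛ
  open Coordinates ℛ
  open Inversions ℛ
  open SetoidReasoning setoid

  total : (Fin 8 → ℝ⁵) → ℝ⁵ → ℝ
  total v y = v 0F • y + v 4F • y

  -- Half the product of the pairings of `y` and `z` with 2 v k - total, without its part ½ (total v
  -- y)(total v z). The basis vectors have square 16 and `total` has square -8; clearing
  -- denominators by 8, the four omitted halves and the contribution -1 of `total` leave the single
  -- product at the end of `parseval`.
  parsevalTerm : (Fin 8 → ℝ⁵) → ℝ⁵ → ℝ⁵ → Fin 8 → ℝ
  parsevalTerm v y z k = 2# * ((v k • y) * (v k • z)) - total v z * (v k • y) - total v y * (v k • z)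

  -- The vectors 2 v k − total, one from each class, and total are orthogonal;
  -- parseval is Parseval's identity for this basis, multiplied out.
  record Frame (v : Fin 8 → ℝ⁵) : Set where
    field
      gram      : ∀ i j → v i • v j ≈ num (gramEntry i j)
      antipodal : ∀ c y → v (c ↑ˡ 4) • y + v (4 ↑ʳ c) • y ≈ total v y
      parseval  : ∀ y z → num (+ 8) * (y • z) ≈
        parsevalTerm v y z 0F + parsevalTerm v y z 1F + parsevalTerm v y z 2F + parsevalTerm v y z 3F
        + total v y * total v z

  open Frame

  parsevalTerm-cong : ∀ {u v y z y′ z′} → (∀ k → u k • y ≈ v k • y′) → (∀ k → u k • z ≈ v k • z′) →
    ∀ k → parsevalTerm u y z k ≈ parsevalTerm v y′ z′ k
  parsevalTerm-cong p q k =
    +-cong (+-cong (*-congˡ (*-cong (p k) (q k))) (-‿cong (*-cong (+-cong (q 0F) (q 4F)) (p k))))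
           (-‿cong (*-cong (+-cong (p 0F) (p 4F)) (q k)))

  -- Pairing `v k` with `y` equals pairing `u k` with `B y`, so each identity for `v` is the one for
  -- `u` with `B` applied to the test vectors.
  frame-transport : ∀ {u v} (B : ℝ⁵ → ℝ⁵) → (∀ x y → B x • B y ≈ x • y) →
    (∀ k y → B (v k) • y ≈ u k • y) → Frame u → Frame v
  frame-transport {u} {v} B isometry Bv≈u U = record
    { gram = λ i j → trans (sym (isometry (v i) (v j))) (trans (Bv≈u i (B (v j)))
        (trans (•-comm (u i) _) (trans (Bv≈u j (u i)) (trans (•-comm (u j) (u i)) (U .gram i j)))))
    ; antipodal = λ c y → trans (+-cong (v≈u (c ↑ˡ 4) y) (v≈u (4 ↑ʳ c) y))
        (trans (U .antipodal c (B y)) (sym (+-cong (v≈u 0F y) (v≈u 4F y))))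
    ; parseval = λ y z → trans (*-congˡ (sym (isometry y z))) (trans (U .parseval (B y) (B z))
        (sym (+-cong (+-cong (+-cong (+-cong (terms y z 0F) (terms y z 1F)) (terms y z 2F)) (terms y z 3F))
          (*-cong (+-cong (v≈u 0F y) (v≈u 4F y)) (+-cong (v≈u 0F z) (v≈u 4F z))))))
    }
    where
    v≈u : ∀ k y → v k • y ≈ u k • B y
    v≈u k y = trans (sym (isometry (v k) y)) (Bv≈u k (B y))
    terms : ∀ y z k → parsevalTerm v y z k ≈ parsevalTerm u (B y) (B z) k
    terms y z = parsevalTerm-cong {v} {u} (λ k → v≈u k y) (λ k → v≈u k z)

  module _ {v : Fin 8 → ℝ⁵} (V : Frame v) where

    -- Passing to the antipode negates 2 v k - total, which leaves a product of two pairings with it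
    -- unchanged.
    parsevalTerm-transversal : ∀ y z c k → class k ≡ c →
      parsevalTerm v y z (c ↑ˡ 4) ≈ parsevalTerm v y z k
    parsevalTerm-transversal y z c k ≡.refl with class-members k
    ... | inj₁ k≡low  = reflexive (≡.cong (parsevalTerm v y z) (≡.sym k≡low))
    ... | inj₂ k≡high = trans
      (eliminate (2# * (v (c ↑ˡ 4) • z) - total v z) (V .antipodal c y)
        (eliminate (total v y - 2# * (v (4 ↑ʳ c) • y)) (V .antipodal c z)
        (solve 6 (λ y y′ z z′ ty tz →
          con (+ 2) :* (y :* z) :- tz :* y :- ty :* z
            :+ (con (+ 2) :* z :- tz) :* ty :+ (ty :- con (+ 2) :* y′) :* tz
          := con (+ 2) :* (y′ :* z′) :- tz :* y′ :- ty :* z′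
            :+ (con (+ 2) :* z :- tz) :* (y :+ y′) :+ (ty :- con (+ 2) :* y′) :* (z :+ z′))
          refl (v (c ↑ˡ 4) • y) (v (4 ↑ʳ c) • y) (v (c ↑ˡ 4) • z) (v (4 ↑ʳ c) • z) (total v y) (total v z))))
      (reflexive (≡.cong (parsevalTerm v y z) (≡.sym k≡high)))

    parseval-transversal : (F : Fin 4 → Fin 8) → (∀ c → class (F c) ≡ c) → ∀ y z → num (+ 8) * (y • z) ≈
      parsevalTerm v y z (F 0F) + parsevalTerm v y z (F 1F) + parsevalTerm v y z (F 2F)
      + parsevalTerm v y z (F 3F) + total v y * total v z
    parseval-transversal F class∘F y z = trans (V .parseval y z)
      (+-congʳ (+-cong (+-cong (+-cong (at 0F) (at 1F)) (at 2F)) (at 3F)))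
      where
      at : ∀ c → parsevalTerm v y z (c ↑ˡ 4) ≈ parsevalTerm v y z (F c)
      at c = parsevalTerm-transversal y z c (F c) (class∘F c)

    -- The vector of a dual sphere

    module Dual (F : Fin 4 → Fin 8) (class∘F : ∀ c → class (F c) ≡ c)
      (t : ℝ⁵) (t•t≈2 : t • t ≈ 2#) (F⊥t : ∀ c → v (F c) • t ≈ 0#) where

      τ : ℝ
      τ = total v t

      excess : ℝ⁵ → ℝ
      excess z = v (F 0F) • z + v (F 1F) • z + v (F 2F) • z + v (F 3F) • z - total v z

      -- In Parseval's identity at `t`, orthogonality reduces each of the four terms to -τ times a
      -- pairing with `z`.
      8t•z : ∀ z → num (+ 8) * (t • z) ≈ - (τ * excess z)
      8t•z z = trans (parseval-transversal F class∘F t z)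
        (trans (+-congʳ (+-cong (+-cong (+-cong (at 0F) (at 1F)) (at 2F)) (at 3F)))
        (solve 6 (λ τ s a b c d →
          :- (τ :* a) :+ :- (τ :* b) :+ :- (τ :* c) :+ :- (τ :* d) :+ τ :* s
          := :- (τ :* (a :+ b :+ c :+ d :- s)))
          refl τ (total v z) (v (F 0F) • z) (v (F 1F) • z) (v (F 2F) • z) (v (F 3F) • z)))
        where
        at : ∀ c → parsevalTerm v t z (F c) ≈ - (τ * (v (F c) • z))
        at c = eliminate (2# * (v (F c) • z) - total v z) (F⊥t c)
          (solve 4 (λ x z s τ →
            con (+ 2) :* (x :* z) :- s :* x :- τ :* z :+ (con (+ 2) :* z :- s) :* con (+ 0)
            := :- (τ :* z) :+ (con (+ 2) :* z :- s) :* x)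
            refl (v (F c) • t) (v (F c) • z) (total v z) τ)

      -- At z = t the excess is -τ and the left side of `8t•z` is 8 · 2.
      τ²≈16 : τ * τ ≈ num (+ 16)
      τ²≈16 = eliminate (- 1#) (8t•z t) (eliminate (num (+ 8)) t•t≈2
        (eliminate τ (F⊥t 0F) (eliminate τ (F⊥t 1F) (eliminate τ (F⊥t 2F) (eliminate τ (F⊥t 3F)
        (solve 6 (λ τ tt a b c d →
          τ :* τ :+ :- con (+ 1) :* :- (τ :* (a :+ b :+ c :+ d :- τ)) :+ con (+ 8) :* con (+ 2)
            :+ τ :* con (+ 0) :+ τ :* con (+ 0) :+ τ :* con (+ 0) :+ τ :* con (+ 0)
          := con (+ 16) :+ :- con (+ 1) :* (con (+ 8) :* tt) :+ con (+ 8) :* tt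
            :+ τ :* a :+ τ :* b :+ τ :* c :+ τ :* d)
          refl τ (t • t) (v (F 0F) • t) (v (F 1F) • t) (v (F 2F) • t) (v (F 3F) • t)))))))

      -- The sign of τ = ±4 depends on the orientation of `t`; multiplying by τ gives a formula free
      -- of that choice.
      τt•z : ∀ z → τ * (t • z) ≈ - (2# * excess z)
      τt•z z = *-cancelˡ-≈ (pos⇒≉0 (num-pos 7))
        (eliminate τ (8t•z z) (eliminate (- excess z) τ²≈16
          (solve 3 (λ τ u e → con (+ 8) :* (τ :* u) :+ τ :* :- (τ :* e) :+ :- e :* con (+ 16)
            := con (+ 8) :* :- (con (+ 2) :* e) :+ τ :* (con (+ 8) :* u) :+ :- e :* (τ :* τ))
            refl τ (t • z) (excess z))))

      -- A sphere is either one of the four orthogonal to `t` or the antipode of one, and then it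
      -- carries the whole antipodal sum τ.
      on-or-off : ∀ k → v k • t ≈ 0# ⊎ v k • t ≈ τ
      on-or-off k with class-members k | class-members (F (class k)) | class∘F (class k)
      ... | inj₁ k≡ | inj₁ F≡ | same = inj₁ (trans
        (reflexive (≡.cong (λ l → v l • t) (≡.trans k≡ (≡.trans (≡.cong (_↑ˡ 4) (≡.sym same)) (≡.sym F≡)))))
          (F⊥t (class k)))
      ... | inj₂ k≡ | inj₂ F≡ | same = inj₁ (trans
        (reflexive (≡.cong (λ l → v l • t) (≡.trans k≡ (≡.trans (≡.cong (4 ↑ʳ_) (≡.sym same)) (≡.sym F≡)))))
          (F⊥t (class k)))
      ... | inj₁ k≡ | inj₂ F≡ | same = inj₂ (trans (sym (+-identityʳ _)) (trans
        (+-cong (reflexive (≡.cong (λ l → v l • t) k≡))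
                (trans (sym (F⊥t (class k))) (reflexive
                  (≡.cong (λ l → v l • t) (≡.trans F≡ (≡.cong (4 ↑ʳ_) same))))))
        (V .antipodal (class k) t)))
      ... | inj₂ k≡ | inj₁ F≡ | same = inj₂ (trans (sym (+-identityˡ _)) (trans
        (+-cong (trans (sym (F⊥t (class k)))
          (reflexive (≡.cong (λ l → v l • t) (≡.trans F≡ (≡.cong (_↑ˡ 4) same)))))
                (reflexive (≡.cong (λ l → v l • t) k≡)))
        (V .antipodal (class k) t)))

  module _ (W : Fin 8 → OrientedSphere) (V : Frame (orientedCoordinates ∘ W)) where

    private
      v : Fin 8 → ℝ⁵
      v = orientedCoordinates ∘ W

    •-⊞ˡ : ∀ x y z → (x ⊞ y) • z ≈ x • z + y • z
    •-⊞ˡ x y z = trans (•-comm _ z) (trans (•-⊞ʳ z x y) (+-cong (•-comm z x) (•-comm z y)))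

    sum-square : ∀ i j {g} → gramEntry i j ≡ g → (v i ⊞ v j) • (v i ⊞ v j) ≈ num (+ 4) + 2# * num g
    sum-square i j ≡.refl = trans (•-⊞ˡ _ _ _) (trans (+-cong (•-⊞ʳ _ _ _) (•-⊞ʳ _ _ _))
      (trans (+-cong (+-cong (diagonal i) (V .gram i j)) (+-cong (trans (•-comm _ _) (V .gram i j)) (diagonal j)))
      (solve 1 (λ g → con (+ 2) :+ g :+ (g :+ con (+ 2))
        := con (+ 4) :+ con (+ 2) :* g) refl (num (gramEntry i j)))))
      where
      diagonal : ∀ i → v i • v i ≈ 2#
      diagonal i = orientedCoordinates-unit (W i)

    -- The sum of the two vectors has square 4 - 12 = -8, so it is timelike; a common point would be
    -- orthogonal to it.
    frame⇒Disjoint : ∀ {i j} → i ≢ j → SameClass i j → Disjoint (sphere (W i)) (sphere (W j))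
    frame⇒Disjoint {i} {j} i≢j same p (p∈i , p∈j) = negative≱0 (orthogonal-to-point⇒nonneg (v i ⊞ v j) p
      (trans (•-⊞ˡ _ _ _) (trans (+-cong (surface⇒•≈0 (W i) p p∈i) (surface⇒•≈0 (W j) p p∈j)) (+-identityˡ 0#))))
      where
      square≈-8 : (v i ⊞ v j) • (v i ⊞ v j) ≈ - num (+ 8)
      square≈-8 = trans (sum-square i j (gramEntry-antipodal {i} {j} i≢j same))
        (solve 0 (con (+ 4) :+ con (+ 2) :* con -[1+ 5 ] := :- con (+ 8)) refl)
      negative≱0 : ¬ (0# ≤ (v i ⊞ v j) • (v i ⊞ v j))
      negative≱0 nonneg = <-irrefl refl (<-respʳ-≈ (trans (+-congˡ square≈-8) (-‿inverseʳ _))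
        (pos+nonneg (num-pos 7) nonneg))

    -- The sum of the two vectors has square 4 - 4 = 0, so it represents a point. That point lies on
    -- both spheres because 2 - 2 = 0, and every common point is orthogonal to the sum, hence equal
    -- to it.
    frame⇒Tangent : ∀ {i j} → ¬ SameClass i j → Tangent (sphere (W i)) (sphere (W j))
    frame⇒Tangent {i} {j} ¬same
      with (p , κ , x•) ← null⇒point (v i ⊞ v j) (trans (sum-square i j (gramEntry-tangent {i} {j} ¬same))
             (solve 0 (con (+ 4) :+ con (+ 2) :* con -[1+ 1 ] := con (+ 0)) refl)) =
      p , (on i vi•x≈0 , on j vj•x≈0) , λ q (q∈i , q∈j) →
        point-separates q p (trans (•-comm (point q) (point p)) (*-cancel-≈0 κ≉0 (trans (sym (x• (point q)))
          (trans (•-⊞ˡ _ _ _) (trans (+-cong (surface⇒•≈0 (W i) q q∈i) (surface⇒•≈0 (W j) q q∈j))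
            (+-identityˡ 0#))))))
      where
      -- A vanishing κ would make the sum pair to zero with `v 0F` and `v 4F`, whereas these two
      -- pairings add up to -4 - 4.
      κ≉0 : ¬ (κ ≈ 0#)
      κ≉0 κ≈0 = pos⇒≉0 (num-pos 7) (-x≈0⇒x≈0 (begin
        - num (+ 8)
          ≈⟨ solve 0 (:- con (+ 8) := con -[1+ 3 ] :+ con -[1+ 3 ]) refl ⟩
        num -[1+ 3 ] + num -[1+ 3 ]
          ≈⟨ +-cong (total-entry i) (total-entry j) ⟨
        v i • v 0F + v i • v 4F + (v j • v 0F + v j • v 4F)
          ≈⟨ solve 4 (λ a b c d → a :+ b :+ (c :+ d) := a :+ c :+ (b :+ d)) refl _ _ _ _ ⟩
        v i • v 0F + v j • v 0F + (v i • v 4F + v j • v 4F)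
          ≈⟨ +-cong (•-⊞ˡ (v i) (v j) (v 0F)) (•-⊞ˡ (v i) (v j) (v 4F)) ⟨
        (v i ⊞ v j) • v 0F + (v i ⊞ v j) • v 4F
          ≈⟨ +-cong (x• (v 0F)) (x• (v 4F)) ⟩
        κ * (point p • v 0F) + κ * (point p • v 4F)
          ≈⟨ +-cong (trans (*-congʳ κ≈0) (zeroˡ _)) (trans (*-congʳ κ≈0) (zeroˡ _)) ⟩
        0# + 0#
          ≈⟨ +-identityˡ 0# ⟩
        0# ∎))
        where
        total-entry : ∀ i → v i • v 0F + v i • v 4F ≈ num -[1+ 3 ]
        total-entry i = trans (+-cong (V .gram i 0F) (V .gram i 4F))
          (trans (sym (Numerals.num-+ (gramEntry i 0F) (gramEntry i 4F)))
            (reflexive (≡.cong num (gramEntry-total i))))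
      on : ∀ k → v k • (v i ⊞ v j) ≈ 0# → p ∈ surface (sphere (W k))
      on k vk•x≈0 = •≈0⇒surface (W k) p (trans (•-comm (v k) (point p)) (*-cancel-≈0 κ≉0
        (trans (sym (x• (v k))) (trans (•-comm _ (v k)) vk•x≈0))))
      vi•vj≈-2 : v i • v j ≈ num -[1+ 1 ]
      vi•vj≈-2 = trans (V .gram i j) (reflexive (≡.cong num (gramEntry-tangent {i} {j} ¬same)))
      vi•x≈0 : v i • (v i ⊞ v j) ≈ 0#
      vi•x≈0 = trans (•-⊞ʳ _ _ _) (trans (+-cong (orientedCoordinates-unit (W i)) vi•vj≈-2) (-‿inverseʳ _))
      vj•x≈0 : v j • (v i ⊞ v j) ≈ 0#
      vj•x≈0 = trans (•-⊞ʳ _ _ _)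
        (trans (+-cong (trans (•-comm _ _) vi•vj≈-2) (orientedCoordinates-unit (W j))) (-‿inverseˡ _))

-- The standard configuration

standardBend standardCobend standardX standardY standardZ : Fin 8 → ℤ
standardBend   = lookup (+ 0 ∷ + 0 ∷ + 1 ∷ + 1 ∷ + 2 ∷ + 2 ∷ + 1 ∷ + 1 ∷ [])
standardCobend = lookup (+ 2 ∷ + 2 ∷ + 1 ∷ + 1 ∷ + 0 ∷ + 0 ∷ + 1 ∷ + 1 ∷ [])
standardX      = lookup (+ 0 ∷ + 0 ∷ + 1 ∷ + 0 ∷ + 0 ∷ + 0 ∷ -[1+ 0 ] ∷ + 0 ∷ [])
standardY      = lookup (+ 0 ∷ + 0 ∷ + 0 ∷ + 1 ∷ + 0 ∷ + 0 ∷ + 0 ∷ -[1+ 0 ] ∷ [])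
standardZ      = lookup (+ 1 ∷ -[1+ 0 ] ∷ + 0 ∷ + 0 ∷ -[1+ 0 ] ∷ + 1 ∷ + 0 ∷ + 0 ∷ [])

-- The tables record the x and y coordinates in units of √2. In pairings √2 enters only squared,
-- which is the factor 2 here, so the Gram matrix can be checked over the integers.
spatialEntry nullEntry : Fin 8 → Fin 8 → ℤ
spatialEntry i j = + 2 ℤ.* (standardX i ℤ.* standardX j ℤ.+ standardY i ℤ.* standardY j)
                   ℤ.+ standardZ i ℤ.* standardZ j
nullEntry i j = standardBend i ℤ.* standardCobend j ℤ.+ standardCobend i ℤ.* standardBend j

standard-gramEntry : ∀ i j → + 2 ℤ.* spatialEntry i j ℤ.- nullEntry i j ≡ gramEntry i j
standard-gramEntry = toWitness
  {a? = all? λ i → all? λ j → (+ 2 ℤ.* spatialEntry i j ℤ.- nullEntry i j) ℤ.≟ gramEntry i j} _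

module StandardFrame (ℛ : CompleteOrderedField) where
  open Geometry ℛ
  open CompleteOrderedField ℛ renaming (Carrier to ℝ)
  open OrderedField ℛ
  open Lorentz ℛ
  open Coordinates ℛ
  open Inversions ℛ
  open Frames ℛ
  open SetoidReasoning setoid

  •-congˡ : ∀ {b b′ b̄ b̄′ x x′ y y′ z z′} → b ≈ b′ → b̄ ≈ b̄′ → x ≈ x′ → y ≈ y′ → z ≈ z′ →
    ∀ v → ⟨ b ∣ b̄ ∣ ⟨ x , y , z ⟩ ⟩ • v ≈ ⟨ b′ ∣ b̄′ ∣ ⟨ x′ , y′ , z′ ⟩ ⟩ • v
  •-congˡ b≈ b̄≈ x≈ y≈ z≈ ⟨ _ ∣ _ ∣ ⟨ _ , _ , _ ⟩ ⟩ =
    +-cong (*-congˡ (+-cong (+-cong (*-congʳ x≈) (*-congʳ y≈)) (*-congʳ z≈)))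
           (-‿cong (+-cong (*-congʳ b≈) (*-congʳ b̄≈)))

  -- `scale` is an unspecified inverse of the radius; cancellation identifies it with any explicit β
  -- such that r β = 1.
  ball-coordinates : ∀ {x y z r} (0<r : 0# < r) β {b̄ x′ y′ z′} → r * β ≈ 1# →
    β * (‖ ⟨ x , y , z ⟩ ‖² - r * r) ≈ b̄ → β * x ≈ x′ → β * y ≈ y′ → β * z ≈ z′ →
    ∀ v → orientedCoordinates (ball ⟨ x , y , z ⟩ r 0<r) • v ≈ ⟨ β ∣ b̄ ∣ ⟨ x′ , y′ , z′ ⟩ ⟩ • v
  ball-coordinates {x} {y} {z} {r} 0<r β rβ≈1 b̄≈ x≈ y≈ z≈ =
    •-congˡ (trans (*-identityˡ _) ρ≈β) (scaled b̄≈) (scaled x≈) (scaled y≈) (scaled z≈)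
    where
    ρ≈β : scale (round ⟨ x , y , z ⟩ r 0<r) ≈ β
    ρ≈β = *-cancelˡ-≈ (pos⇒≉0 0<r) (trans (radius*scale≈1 ⟨ x , y , z ⟩ r 0<r) (sym rβ≈1))
    scaled : ∀ {u u′} → β * u ≈ u′ → 1# * (scale (round ⟨ x , y , z ⟩ r 0<r) * u) ≈ u′
    scaled eq = trans (*-identityˡ _) (trans (*-congʳ ρ≈β) eq)

  module _ (√2 : ℝ) (√2²≈2 : √2 * √2 ≈ 2#) where

    standardVector : Fin 8 → ℝ⁵
    standardVector k = ⟨ num (standardBend k) ∣ num (standardCobend k) ∣
      ⟨ num (standardX k) * √2 , num (standardY k) * √2 , num (standardZ k) ⟩ ⟩

    2*½≈1 : 2# * ½ ≈ 1#
    2*½≈1 = proj₂ (inverse 2# (pos⇒≉0 0<2))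

    unit-cobend : ∀ {q} → q ≈ √2 * √2 → 1# * (q - 1# * 1#) ≈ 1#
    unit-cobend {q} q≈s² = eliminate 1# (trans q≈s² √2²≈2)
      (solve 1 (λ q → con (+ 1) :* (q :- con (+ 1) :* con (+ 1)) :+ con (+ 1) :* con (+ 2)
        := con (+ 1) :+ con (+ 1) :* q) refl q)

    zero-coordinate : ∀ a → a * 0# ≈ 0# * √2
    zero-coordinate a = trans (zeroʳ a) (sym (zeroˡ √2))

    standard-coordinates : ∀ k y → orientedCoordinates (standard √2 k) • y ≈ standardVector k • y
    standard-coordinates 0F = •-congˡ (zeroʳ _)
      (solve 0 (:- con (+ 1) :* :- (con (+ 2) :* con (+ 1)) := con (+ 2)) refl) plane-zero plane-zero
      (solve 0 (:- con (+ 1) :* (:- con (+ 1) :* con (+ 1)) := con (+ 1)) refl)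
      where
      plane-zero : - 1# * (- 1# * 0#) ≈ 0# * √2
      plane-zero = solve 1 (λ s → :- con (+ 1) :* (:- con (+ 1) :* con (+ 0)) := con (+ 0) :* s) refl √2
    standard-coordinates 1F = •-congˡ (zeroʳ _)
      (solve 0 (con (+ 1) :* :- (con (+ 2) :* :- con (+ 1)) := con (+ 2)) refl) plane-zero plane-zero
      (solve 0 (con (+ 1) :* (:- con (+ 1) :* con (+ 1)) := :- con (+ 1)) refl)
      where
      plane-zero : 1# * (- 1# * 0#) ≈ 0# * √2
      plane-zero = solve 1 (λ s → con (+ 1) :* (:- con (+ 1) :* con (+ 0)) := con (+ 0) :* s) refl √2
    standard-coordinates 2F = ball-coordinates 0<1 1# (*-identityˡ 1#)
      (unit-cobend (solve 1 (λ s → s :* s :+ con (+ 0) :* con (+ 0) :+ con (+ 0) :* con (+ 0) := s :* s) refl √2))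
      refl (zero-coordinate 1#) (zeroʳ 1#)
    standard-coordinates 3F = ball-coordinates 0<1 1# (*-identityˡ 1#)
      (unit-cobend (solve 1 (λ s → con (+ 0) :* con (+ 0) :+ s :* s :+ con (+ 0) :* con (+ 0) := s :* s) refl √2))
      (zero-coordinate 1#) refl (zeroʳ 1#)
    standard-coordinates 4F = ball-coordinates 0<½ 2# (trans (*-comm ½ 2#) 2*½≈1)
      (solve 1 (λ h → con (+ 2) :* (con (+ 0) :* con (+ 0) :+ con (+ 0) :* con (+ 0) :+ :- h :* :- h :- h :* h)
        := con (+ 0)) refl ½)
      (zero-coordinate 2#) (zero-coordinate 2#)
      (trans (solve 1 (λ h → con (+ 2) :* :- h := :- (con (+ 2) :* h)) refl ½) (-‿cong 2*½≈1))
    standard-coordinates 5F = ball-coordinates 0<½ 2# (trans (*-comm ½ 2#) 2*½≈1)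
      (solve 1 (λ h → con (+ 2) :* (con (+ 0) :* con (+ 0) :+ con (+ 0) :* con (+ 0) :+ h :* h :- h :* h)
        := con (+ 0)) refl ½)
      (zero-coordinate 2#) (zero-coordinate 2#) 2*½≈1
    standard-coordinates 6F = ball-coordinates 0<1 1# (*-identityˡ 1#)
      (unit-cobend (solve 1 (λ s → :- s :* :- s :+ con (+ 0) :* con (+ 0) :+ con (+ 0) :* con (+ 0)
        := s :* s) refl √2))
      (solve 1 (λ s → con (+ 1) :* :- s := :- con (+ 1) :* s) refl √2) (zero-coordinate 1#) (zeroʳ 1#)
    standard-coordinates 7F = ball-coordinates 0<1 1# (*-identityˡ 1#)
      (unit-cobend (solve 1 (λ s → con (+ 0) :* con (+ 0) :+ :- s :* :- s :+ con (+ 0) :* con (+ 0)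
        := s :* s) refl √2))
      (zero-coordinate 1#) (solve 1 (λ s → con (+ 1) :* :- s := :- con (+ 1) :* s) refl √2) (zeroʳ 1#)

    standardVector-gram : ∀ i j → standardVector i • standardVector j ≈ num (gramEntry i j)
    standardVector-gram i j = begin
      standardVector i • standardVector j
        ≈⟨ +-congʳ (*-congˡ spatial) ⟩
      2# * num (spatialEntry i j)
        - (num (standardBend i) * num (standardCobend j) + num (standardCobend i) * num (standardBend j))
        ≈⟨ +-cong (num-* (+ 2) (spatialEntry i j)) (trans (num-neg (nullEntry i j)) (-‿cong
             (trans (num-+ (standardBend i ℤ.* standardCobend j) (standardCobend i ℤ.* standardBend j))
               (+-cong (num-* (standardBend i) (standardCobend j)) (num-* (standardCobend i) (standardBend j))))))
                 ⟨
      num (+ 2 ℤ.* spatialEntry i j) + num (ℤ.- nullEntry i j)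
        ≈⟨ num-+ (+ 2 ℤ.* spatialEntry i j) (ℤ.- nullEntry i j) ⟨
      num (+ 2 ℤ.* spatialEntry i j ℤ.- nullEntry i j)
        ≡⟨ ≡.cong num (standard-gramEntry i j) ⟩
      num (gramEntry i j) ∎
      where
      open Numerals using (num-+; num-*; num-neg)
      xx yy zz : ℤ
      xx = standardX i ℤ.* standardX j
      yy = standardY i ℤ.* standardY j
      zz = standardZ i ℤ.* standardZ j
      spatial : num (standardX i) * √2 * (num (standardX j) * √2)
        + num (standardY i) * √2 * (num (standardY j) * √2)
                + num (standardZ i) * num (standardZ j) ≈ num (spatialEntry i j)
      spatial = begin
        num (standardX i) * √2 * (num (standardX j) * √2) + num (standardY i) * √2 * (num (standardY j) * √2)
          + num (standardZ i) * num (standardZ j)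
          ≈⟨ solve 6 (λ s x x′ y y′ zz → x :* s :* (x′ :* s) :+ y :* s :* (y′ :* s) :+ zz
               := s :* s :* (x :* x′ :+ y :* y′) :+ zz) refl √2 _ _ _ _ _ ⟩
        √2 * √2 * (num (standardX i) * num (standardX j) + num (standardY i) * num (standardY j))
          + num (standardZ i) * num (standardZ j)
          ≈⟨ +-cong (*-cong (sym √2²≈2) (trans (num-+ xx yy)
               (+-cong (num-* (standardX i) (standardX j)) (num-* (standardY i) (standardY j)))))
               (num-* (standardZ i) (standardZ j)) ⟨
        2# * num (xx ℤ.+ yy) + num zz
          ≈⟨ trans (num-+ (+ 2 ℤ.* (xx ℤ.+ yy)) zz) (+-congʳ (num-* (+ 2) (xx ℤ.+ yy))) ⟨
        num (spatialEntry i j) ∎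

    pairing : ∀ b b̄ x y z → Fin 8 → ℝ
    pairing b b̄ x y z = lookup
      ( 2# * z - 2# * b ∷ - (2# * z) - 2# * b ∷ 2# * (√2 * x) - (b + b̄) ∷ 2# * (√2 * y) - (b + b̄)
      ∷ - (2# * z) - 2# * b̄ ∷ 2# * z - 2# * b̄ ∷ - (2# * (√2 * x)) - (b + b̄) ∷ - (2# * (√2 * y))
        - (b + b̄) ∷ [] )

    standardVector-pairing : ∀ b b̄ x y z k → standardVector k • ⟨ b ∣ b̄ ∣ ⟨ x , y , z ⟩ ⟩ ≈ pairing b b̄ x y z k
    standardVector-pairing b b̄ x y z = λ where
        0F → solve 6 (λ b b̄ x y z s → product (con (+ 0)) (con (+ 2)) (con (+ 0)) (con (+ 0)) (con (+ 1)) b b̄ x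
          y z s
               := two :* z :- two :* b) refl b b̄ x y z √2
        1F → solve 6 (λ b b̄ x y z s → product (con (+ 0)) (con (+ 2)) (con (+ 0)) (con (+ 0)) (:- con (+ 1)) b b̄
          x y z s
               := :- (two :* z) :- two :* b) refl b b̄ x y z √2
        2F → solve 6 (λ b b̄ x y z s → product (con (+ 1)) (con (+ 1)) (con (+ 1)) (con (+ 0)) (con (+ 0)) b b̄ x
          y z s
               := two :* (s :* x) :- (b :+ b̄)) refl b b̄ x y z √2
        3F → solve 6 (λ b b̄ x y z s → product (con (+ 1)) (con (+ 1)) (con (+ 0)) (con (+ 1)) (con (+ 0)) b b̄ x
          y z s
               := two :* (s :* y) :- (b :+ b̄)) refl b b̄ x y z √2
        4F → solve 6 (λ b b̄ x y z s → product (con (+ 2)) (con (+ 0)) (con (+ 0)) (con (+ 0)) (:- con (+ 1)) b b̄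
          x y z s
               := :- (two :* z) :- two :* b̄) refl b b̄ x y z √2
        5F → solve 6 (λ b b̄ x y z s → product (con (+ 2)) (con (+ 0)) (con (+ 0)) (con (+ 0)) (con (+ 1)) b b̄ x
          y z s
               := two :* z :- two :* b̄) refl b b̄ x y z √2
        6F → solve 6 (λ b b̄ x y z s → product (con (+ 1)) (con (+ 1)) (:- con (+ 1)) (con (+ 0)) (con (+ 0)) b b̄
          x y z s
               := :- (two :* (s :* x)) :- (b :+ b̄)) refl b b̄ x y z √2
        7F → solve 6 (λ b b̄ x y z s → product (con (+ 1)) (con (+ 1)) (con (+ 0)) (:- con (+ 1)) (con (+ 0)) b b̄
          x y z s
               := :- (two :* (s :* y)) :- (b :+ b̄)) refl b b̄ x y z √2
      where
      two : ∀ {n} → Polynomial n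
      two = con (+ 2)
      product : ∀ {n} (β β̄ ξ η ζ b b̄ x y z s : Polynomial n) → Polynomial n
      product β β̄ ξ η ζ b b̄ x y z s =
        con (+ 2) :* (ξ :* s :* x :+ η :* s :* y :+ ζ :* z) :- (β :* b̄ :+ β̄ :* b)

    standardVector-frame : Frame standardVector
    standardVector-frame = record
      { gram = standardVector-gram
      ; antipodal = antipodal
      ; parseval = parseval
      }
      where
      total≈ : ∀ b b̄ x y z → total standardVector ⟨ b ∣ b̄ ∣ ⟨ x , y , z ⟩ ⟩ ≈ - (2# * (b + b̄))
      total≈ b b̄ x y z = trans (+-cong (standardVector-pairing b b̄ x y z 0F)
        (standardVector-pairing b b̄ x y z 4F))
        (solve 3 (λ b b̄ z → con (+ 2) :* z :- con (+ 2) :* b :+ (:- (con (+ 2) :* z) :- con (+ 2) :* b̄)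
          := :- (con (+ 2) :* (b :+ b̄))) refl b b̄ z)
      antipodal : ∀ c y → standardVector (c ↑ˡ 4) • y + standardVector (4 ↑ʳ c) • y ≈ total standardVector y
      antipodal c v@(⟨ b ∣ b̄ ∣ ⟨ x , y , z ⟩ ⟩) =
        trans (+-cong (standardVector-pairing b b̄ x y z (c ↑ˡ 4)) (standardVector-pairing b b̄ x y z (4 ↑ʳ c)))
          (trans (sum c) (sym (total≈ b b̄ x y z)))
        where
        sum : ∀ c → pairing b b̄ x y z (c ↑ˡ 4) + pairing b b̄ x y z (4 ↑ʳ c) ≈ - (2# * (b + b̄))
        sum 0F = solve 3 (λ b b̄ z → con (+ 2) :* z :- con (+ 2) :* b :+ (:- (con (+ 2) :* z) :- con (+ 2) :* b̄)
          := :- (con (+ 2) :* (b :+ b̄))) refl b b̄ z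
        sum 1F = solve 3 (λ b b̄ z → :- (con (+ 2) :* z) :- con (+ 2) :* b :+ (con (+ 2) :* z :- con (+ 2) :* b̄)
          := :- (con (+ 2) :* (b :+ b̄))) refl b b̄ z
        sum 2F = solve 3 (λ b b̄ t → con (+ 2) :* t :- (b :+ b̄) :+ (:- (con (+ 2) :* t) :- (b :+ b̄))
          := :- (con (+ 2) :* (b :+ b̄))) refl b b̄ (√2 * x)
        sum 3F = solve 3 (λ b b̄ t → con (+ 2) :* t :- (b :+ b̄) :+ (:- (con (+ 2) :* t) :- (b :+ b̄))
          := :- (con (+ 2) :* (b :+ b̄))) refl b b̄ (√2 * y)
      parseval : ∀ y z → num (+ 8) * (y • z) ≈
        parsevalTerm standardVector y z 0F + parsevalTerm standardVector y z 1F
        + parsevalTerm standardVector y z 2F + parsevalTerm standardVector y z 3F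
        + total standardVector y * total standardVector z
      parseval u@(⟨ b ∣ b̄ ∣ ⟨ x , y , z ⟩ ⟩) v@(⟨ b′ ∣ b̄′ ∣ ⟨ x′ , y′ , z′ ⟩ ⟩) = trans
        -- The terms linear in √2 cancel, and classes 2 and 3 contribute 8 √2² (x x′ + y y′), whence
        -- the cofactor of √2² = 2.
        (eliminate (- (num (+ 8) * (x * x′ + y * y′))) √2²≈2
        (solve 11 (λ b b̄ x y z b′ b̄′ x′ y′ z′ s →
          con (+ 8) :* (con (+ 2) :* (x :* x′ :+ y :* y′ :+ z :* z′) :- (b :* b̄′ :+ b̄ :* b′))
            :+ :- (con (+ 8) :* (x :* x′ :+ y :* y′)) :* con (+ 2)
          := (term (con (+ 2) :* z :- con (+ 2) :* b) (con (+ 2) :* z′ :- con (+ 2) :* b′) b b̄ b′ b̄′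
              :+ term (:- (con (+ 2) :* z) :- con (+ 2) :* b) (:- (con (+ 2) :* z′) :- con (+ 2) :* b′) b b̄ b′
                b̄′
              :+ term (con (+ 2) :* (s :* x) :- (b :+ b̄)) (con (+ 2) :* (s :* x′) :- (b′ :+ b̄′)) b b̄ b′ b̄′
              :+ term (con (+ 2) :* (s :* y) :- (b :+ b̄)) (con (+ 2) :* (s :* y′) :- (b′ :+ b̄′)) b b̄ b′ b̄′
              :+ :- (con (+ 2) :* (b :+ b̄)) :* :- (con (+ 2) :* (b′ :+ b̄′)))
            :+ :- (con (+ 8) :* (x :* x′ :+ y :* y′)) :* (s :* s))
          refl b b̄ x y z b′ b̄′ x′ y′ z′ √2))
        (sym (+-cong (+-cong (+-cong (+-cong (at 0F) (at 1F)) (at 2F)) (at 3F))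
          (*-cong (total≈ b b̄ x y z) (total≈ b′ b̄′ x′ y′ z′))))
        where
        term : ∀ {n} (p q b b̄ b′ b̄′ : Polynomial n) → Polynomial n
        term p q b b̄ b′ b̄′ = con (+ 2) :* (p :* q) :- :- (con (+ 2) :* (b′ :+ b̄′)) :* p
          :- :- (con (+ 2) :* (b :+ b̄)) :* q
        at : ∀ k → parsevalTerm standardVector u v k ≈
          2# * (pairing b b̄ x y z k * pairing b′ b̄′ x′ y′ z′ k)
          - - (2# * (b′ + b̄′)) * pairing b b̄ x y z k - - (2# * (b + b̄)) * pairing b′ b̄′ x′ y′ z′ k
        at k = +-cong (+-cong (*-congˡ (*-cong p q)) (-‿cong (*-cong (total≈ b′ b̄′ x′ y′ z′) p)))
                      (-‿cong (*-cong (total≈ b b̄ x y z) q))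
          where
          p = standardVector-pairing b b̄ x y z k
          q = standardVector-pairing b′ b̄′ x′ y′ z′ k

    standard-frame : Frame (orientedCoordinates ∘ standard √2)
    standard-frame = frame-transport {standardVector} id (λ _ _ → refl) standard-coordinates standardVector-frame

-- Bends within a packing

module Packings (ℛ : CompleteOrderedField) where
  open Geometry ℛ
  open CompleteOrderedField ℛ renaming (Carrier to ℝ)
  open OrderedField ℛ
  open Lorentz ℛ
  open Coordinates ℛ
  open Inversions ℛ
  open Frames ℛ
  open StandardFrame ℛ
  open SetoidReasoning setoid

  HasFrame : Configuration → Set
  HasFrame W = Frame (orientedCoordinates ∘ W)

  möbius-frame : ∀ {φ} V W → IsMöbius φ → ConfigurationMapsTo φ V W → HasFrame V → HasFrame W
  möbius-frame V W μ maps = frame-transport {orientedCoordinates ∘ V} {orientedCoordinates ∘ W}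
    (pullback μ) (pullback-isometry μ) (λ k → pullback-MapsTo μ {V k} {W k} (maps k))

  orthoplicial-frame : ∀ V → IsOrthoplicial V → HasFrame V
  orthoplicial-frame V (√2 , (_ , √2²≈2) , φ , μ , maps) =
    möbius-frame (standard √2) V μ maps (standard-frame √2 √2²≈2)

  totalBend : Configuration → ℝ
  totalBend W = bend (W 0F) + bend (W 4F)

  bendSum : Configuration → (Fin 4 → Fin 8) → ℝ
  bendSum W F = bend (W (F 0F)) + bend (W (F 1F)) + bend (W (F 2F)) + bend (W (F 3F))

  •∞≈-bend : ∀ S → orientedCoordinates S • point ∞ ≈ - bend S
  •∞≈-bend S = trans (sym (-‿involutive _)) (-‿cong (sym (bend-coordinates S)))
    where open RingProperties ring using (-‿involutive)

  total≈-totalBend : ∀ W → total (orientedCoordinates ∘ W) (point ∞) ≈ - totalBend W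
  total≈-totalBend W = trans (+-cong (•∞≈-bend (W 0F)) (•∞≈-bend (W 4F)))
    (solve 2 (λ a b → :- a :+ :- b := :- (a :+ b)) refl _ _)

  antipodal-bends : ∀ W → HasFrame W → ∀ c → bend (W (4 ↑ʳ c)) ≈ totalBend W - bend (W (c ↑ˡ 4))
  antipodal-bends W V c = eliminate (- 1#)
    (trans (sym (+-cong (•∞≈-bend (W (c ↑ˡ 4))) (•∞≈-bend (W (4 ↑ʳ c)))))
      (trans (Frame.antipodal V c (point ∞)) (total≈-totalBend W)))
    (solve 3 (λ a b s → b :+ :- con (+ 1) :* :- s := s :- a :+ :- con (+ 1) :* (:- a :+ :- b)) refl _ _ _)

  -- Parseval's identity with both vectors equal to `point ∞`: the left side vanishes because that
  -- vector is null, and every pairing on the right is minus a bend.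
  bend-relation : ∀ W → HasFrame W → (F : Fin 4 → Fin 8) → (∀ c → class (F c) ≡ c) →
    let b = λ c → bend (W (F c)) in
    totalBend W * totalBend W ≈
    2# * (totalBend W * bendSum W F - (b 0F * b 0F + b 1F * b 1F + b 2F * b 2F + b 3F * b 3F))
  bend-relation W V F class∘F = eliminate (- 1#) 0≈parseval
    (solve 5 (λ s a b c d →
      s :* s :+ :- con (+ 1) :* (term s a :+ term s b :+ term s c :+ term s d :+ :- s :* :- s)
      := con (+ 2) :* (s :* (a :+ b :+ c :+ d) :- (a :* a :+ b :* b :+ c :* c :+ d :* d))
        :+ :- con (+ 1) :* con (+ 0))
      refl (totalBend W) (b 0F) (b 1F) (b 2F) (b 3F))
    where
    v = orientedCoordinates ∘ W
    b : Fin 4 → ℝ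
    b c = bend (W (F c))
    term : ∀ {n} → Polynomial n → Polynomial n → Polynomial n
    term s x = con (+ 2) :* (:- x :* :- x) :- :- s :* :- x :- :- s :* :- x
    at : ∀ c → parsevalTerm v (point ∞) (point ∞) (F c) ≈
      2# * (- b c * - b c) - - totalBend W * - b c - - totalBend W * - b c
    at c = +-cong (+-cong (*-congˡ (*-cong p p)) (-‿cong (*-cong (total≈-totalBend W) p)))
                  (-‿cong (*-cong (total≈-totalBend W) p))
      where p = •∞≈-bend (W (F c))
    0≈parseval = trans (sym (trans (*-congˡ (point-null ∞)) (zeroʳ (num (+ 8)))))
      (trans (parseval-transversal V F class∘F (point ∞) (point ∞))
        (+-cong (+-cong (+-cong (+-cong (at 0F) (at 1F)) (at 2F)) (at 3F))
          (*-cong (total≈-totalBend W) (total≈-totalBend W))))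

  fromℤ-sum : ∀ {x y} i j → x ≈ fromℤ i → y ≈ fromℤ j → x + y ≈ fromℤ (i ℤ.+ j)
  fromℤ-sum i j p q = trans (+-cong p q) (sym (fromℤ-+ i j))

  fromℤ-sum₄ : ∀ {x y z w} i j k l → x ≈ fromℤ i → y ≈ fromℤ j → z ≈ fromℤ k → w ≈ fromℤ l →
    x + y + z + w ≈ fromℤ (i ℤ.+ j ℤ.+ k ℤ.+ l)
  fromℤ-sum₄ i j k l p q r t = fromℤ-sum (i ℤ.+ j ℤ.+ k) l (fromℤ-sum (i ℤ.+ j) k (fromℤ-sum i j p q) r) t

  fromℤ-bend-relation : ∀ W → HasFrame W → (n : Fin 8 → ℤ) → (∀ k → bend (W k) ≈ fromℤ (n k)) →
    (F : Fin 4 → Fin 8) → (∀ c → class (F c) ≡ c) →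
    Descartes (n (F 0F)) (n (F 1F)) (n (F 2F)) (n (F 3F)) (n 0F ℤ.+ n 4F)
  fromℤ-bend-relation W V n b≈n F class∘F = descartes (fromℤ-injective (begin
    fromℤ (s ℤ.* s)
      ≈⟨ fromℤ-* s s ⟩
    fromℤ s * fromℤ s
      ≈⟨ *-cong s≈ s≈ ⟨
    totalBend W * totalBend W
      ≈⟨ bend-relation W V F class∘F ⟩
    2# * (totalBend W * bendSum W F - _)
      ≈⟨ *-cong (sym (Numerals.fromℤ≈num (+ 2)))
        (+-cong (*-cong s≈ (fromℤ-sum₄ (n (F 0F)) (n (F 1F)) (n (F 2F)) (n (F 3F)) (at 0F) (at 1F) (at 2F)
          (at 3F)))
           (-‿cong (fromℤ-sum₄ (sq 0F) (sq 1F) (sq 2F) (sq 3F) (square 0F) (square 1F) (square 2F) (square 3F))))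
             ⟩
    fromℤ (+ 2) * (fromℤ s * fromℤ Σn - fromℤ Σn²)
      ≈⟨ trans (fromℤ-* (+ 2) (s ℤ.* Σn ℤ.- Σn²)) (*-congˡ (trans (fromℤ-+ (s ℤ.* Σn) (ℤ.- Σn²))
           (+-cong (fromℤ-* s Σn) (fromℤ-neg Σn²)))) ⟨
    fromℤ (+ 2 ℤ.* (s ℤ.* Σn ℤ.- Σn²)) ∎))
    where
    sq : Fin 4 → ℤ
    sq c = n (F c) ℤ.* n (F c)
    s Σn Σn² : ℤ
    s = n 0F ℤ.+ n 4F
    Σn = n (F 0F) ℤ.+ n (F 1F) ℤ.+ n (F 2F) ℤ.+ n (F 3F)
    Σn² = sq 0F ℤ.+ sq 1F ℤ.+ sq 2F ℤ.+ sq 3F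
    at : ∀ c → bend (W (F c)) ≈ fromℤ (n (F c))
    at c = b≈n (F c)
    square : ∀ c → bend (W (F c)) * bend (W (F c)) ≈ fromℤ (sq c)
    square c = trans (*-cong (at c) (at c)) (sym (fromℤ-* (n (F c)) (n (F c))))
    s≈ : totalBend W ≈ fromℤ s
    s≈ = fromℤ-sum (n 0F) (n 4F) (b≈n 0F) (b≈n 4F)

  -- Two spheres of the same class are disjoint, so four pairwise tangent ones occupy four different
  -- classes. By the pigeonhole principle they can be reindexed by class.
  dual⇒transversal : ∀ W → HasFrame W → (Q : Quadruple W) (T : Sphere) → T ∈ IsDual W Q →
    ∃ λ F → ∀ c → class (F c) ≡ c × orientedCoordinates (W (F c)) • coordinates T ≈ 0#
  dual⇒transversal W V Q T dual = index ∘ position , λ c →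
      proj₂ (injective⇒surjective (class ∘ index) class∘index-injective c) , orthogonal (position c)
    where
    open Quadruple Q
    class∘index-injective : ∀ {i j} → class (index i) ≡ class (index j) → i ≡ j
    class∘index-injective {i} {j} same with i Fin.≟ j
    ... | yes i≡j = i≡j
    ... | no i≢j with (p , p∈ , _) ← pairwiseTangent i j i≢j = contradiction p∈
      (frame⇒Disjoint W V {index i} {index j} (λ eq → i≢j (injective eq))
        (class≡⇒SameClass {index i} {index j} same) p)
    position : Fin 4 → Fin 4
    position c = proj₁ (injective⇒surjective (class ∘ index) class∘index-injective c)
    orthogonal : ∀ i → orientedCoordinates (W (index i)) • coordinates T ≈ 0#
    orthogonal i = trans (⊡-•ˡ (sign (side S)) (coordinates (sphere S)) (coordinates T))
      (trans (*-congˡ (trans (•-comm (coordinates (sphere S)) (coordinates T))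
        (Orthogonal⇒•≈0 T (sphere S) (dual i)))) (zeroʳ (sign (side S))))
      where S = W (index i)

  -- What is known is the reflected vector of `S′`, which pairs like that of `S`. Applying the
  -- isometry to both arguments moves the reflection to `point ∞`, where it can be expanded.
  reflected-bend : ∀ {S S′} T → MapsTo (inversion T) S S′ →
    bend S′ ≈ bend S + (orientedCoordinates S • coordinates T) * (coordinates T • point ∞)
  reflected-bend {S} {S′} T maps = begin
    bend S′
      ≈⟨ bend-coordinates S′ ⟩
    - (v′ • point ∞)
      ≈⟨ -‿cong (reflection-isometry t (coordinates-unit T) v′ (point ∞)) ⟨
    - (reflection t v′ • reflection t (point ∞))
      ≈⟨ -‿cong (trans (pullback-MapsTo (invert T identity) {S} {S′} maps (reflection t (point ∞)))
           (•-comm v (reflection t (point ∞)))) ⟩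
    - (reflection t (point ∞) • v)
      ≈⟨ -‿cong (trans (reflection-• t (point ∞) v) (+-cong (trans (•-comm (point ∞) v) (•∞≈-bend S))
           (-‿cong (*-cong (•-comm (point ∞) t) (•-comm t v))))) ⟩
    - (- bend S - (t • point ∞) * (v • t))
      ≈⟨ solve 3 (λ b x y → :- (:- b :- x :* y) := b :+ y :* x) refl (bend S) (t • point ∞) (v • t) ⟩
    bend S + (v • t) * (t • point ∞) ∎
    where
    t = coordinates T
    v = orientedCoordinates S
    v′ = orientedCoordinates S′

  ∃n′-respˡ : ∀ {x y n} → x ≈ y → ∃ (λ n′ → y ≈ fromℤ n′ × + 4 ∣ n′ ℤ.- n) →
    ∃ λ n′ → x ≈ fromℤ n′ × + 4 ∣ n′ ℤ.- n
  ∃n′-respˡ x≈y (n′ , eq , n′≡n) = n′ , trans x≈y eq , n′≡n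

  -- The jump is twice Σb - s, so evenness of the latter, which is the parity half of `classify`,
  -- makes it a multiple of 4.
  integral-jump : ∀ {b Σb t} n Σn s → b ≈ fromℤ n → Σb ≈ fromℤ Σn → t ≈ fromℤ s → + 2 ∣ Σn ℤ.- s →
    ∃ λ n′ → b + 2# * (Σb - t) ≈ fromℤ n′ × + 4 ∣ n′ ℤ.- n
  integral-jump n Σn s b≈ Σb≈ t≈ even =
    n ℤ.+ + 2 ℤ.* (Σn ℤ.- s) ,
    fromℤ-sum n (+ 2 ℤ.* (Σn ℤ.- s)) b≈
      (trans (*-cong (sym (Numerals.fromℤ≈num (+ 2)))
                     (fromℤ-sum Σn (ℤ.- s) Σb≈ (trans (-‿cong t≈) (sym (fromℤ-neg s)))))
             (sym (fromℤ-* (+ 2) (Σn ℤ.- s)))) ,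
    ∣-shift n (Σn ℤ.- s) even

  module Reflection (W W′ : Configuration) (V : HasFrame W) (T : Sphere)
    (maps : ConfigurationMapsTo (inversion T) W W′)
    (F : Fin 4 → Fin 8) (class∘F : ∀ c → class (F c) ≡ c)
    (F⊥T : ∀ c → orientedCoordinates (W (F c)) • coordinates T ≈ 0#) where

    open Dual V F class∘F (coordinates T) (coordinates-unit T) F⊥T

    excess-bend : excess (point ∞) ≈ - (bendSum W F - totalBend W)
    excess-bend = trans (+-cong (+-cong (+-cong (+-cong (at 0F) (at 1F)) (at 2F)) (at 3F))
      (-‿cong (total≈-totalBend W)))
      (solve 5 (λ a b c d s → :- a :+ :- b :+ :- c :+ :- d :- :- s := :- (a :+ b :+ c :+ d :- s)) refl
        (bend (W (F 0F))) (bend (W (F 1F))) (bend (W (F 2F))) (bend (W (F 3F))) (totalBend W))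
      where
      at : ∀ c → orientedCoordinates (W (F c)) • point ∞ ≈ - bend (W (F c))
      at c = •∞≈-bend (W (F c))

    -- The four spheres orthogonal to `T` keep their bends; for their antipodes the jump is τ (t •
    -- ∞), which `τt•z` evaluates without the sign of τ.
    bend-step : ∀ k → bend (W′ k) ≈ bend (W k) ⊎
      bend (W′ k) ≈ bend (W k) + 2# * (bendSum W F - totalBend W)
    bend-step k = Sum.map
      (λ off → trans (reflected-bend {W k} {W′ k} T (maps k))
        (trans (+-congˡ (trans (*-congʳ off) (zeroˡ (coordinates T • point ∞)))) (+-identityʳ (bend (W k)))))
      (λ on → trans (reflected-bend {W k} {W′ k} T (maps k)) (+-congˡ (trans (*-congʳ on) (trans (τt•z (point ∞))
        (trans (-‿cong (*-congˡ excess-bend))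
          (solve 1 (λ e → :- (con (+ 2) :* :- e) := con (+ 2) :* e) refl (bendSum W F - totalBend W)))))))
      (on-or-off k)

    even-excess : (n : Fin 8 → ℤ) → (∀ k → bend (W k) ≈ fromℤ (n k)) →
      + 2 ∣ n (F 0F) ℤ.+ n (F 1F) ℤ.+ n (F 2F) ℤ.+ n (F 3F) ℤ.- (n 0F ℤ.+ n 4F)
    even-excess n b≈n = proj₁ (classify (n (F 0F)) (n (F 1F)) (n (F 2F)) (n (F 3F)) (n 0F ℤ.+ n 4F)
      (fromℤ-bend-relation W V n b≈n F class∘F))

    integral-step : (n : Fin 8 → ℤ) → (∀ k → bend (W k) ≈ fromℤ (n k)) →
      ∀ k → ∃ λ n′ → bend (W′ k) ≈ fromℤ n′ × + 4 ∣ n′ ℤ.- n k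
    integral-step n b≈n k = Sum.[ unchanged , jumped ] (bend-step k)
      where
      unchanged : bend (W′ k) ≈ bend (W k) → ∃ λ n′ → bend (W′ k) ≈ fromℤ n′ × + 4 ∣ n′ ℤ.- n k
      unchanged same = n k , trans same (b≈n k) , i∣i-i (n k)
      jumped : bend (W′ k) ≈ bend (W k) + 2# * (bendSum W F - totalBend W) →
        ∃ λ n′ → bend (W′ k) ≈ fromℤ n′ × + 4 ∣ n′ ℤ.- n k
      jumped jump = ∃n′-respˡ jump
        (integral-jump (n k) (n (F 0F) ℤ.+ n (F 1F) ℤ.+ n (F 2F) ℤ.+ n (F 3F)) (n 0F ℤ.+ n 4F)
          (b≈n k)
          (fromℤ-sum₄ (n (F 0F)) (n (F 1F)) (n (F 2F)) (n (F 3F))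
            (b≈n (F 0F)) (b≈n (F 1F)) (b≈n (F 2F)) (b≈n (F 3F)))
          (fromℤ-sum (n 0F) (n 4F) (b≈n 0F) (b≈n 4F))
          (even-excess n b≈n))

  module _ (V₀ : Configuration) (frame₀ : HasFrame V₀)
    (N : Fin 8 → ℤ) (bend₀ : ∀ k → bend (V₀ k) ≈ fromℤ (N k)) where

    -- The residues are compared with those of the same index in the initial configuration. The
    -- frame is carried along because each inversion needs the bend relation of the configuration it
    -- is applied to.
    family-invariant : ∀ {W} → W ∈ Family V₀ →
      HasFrame W × (∀ k → ∃ λ n → bend (W k) ≈ fromℤ n × + 4 ∣ n ℤ.- N k)
    family-invariant initial = frame₀ , λ k → N k , bend₀ k , i∣i-i (N k)
    family-invariant (reflect {W} {W′} W∈ Q T dual maps) =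
      let (V , bends) = family-invariant W∈
          (F , F-spec) = dual⇒transversal W V Q T dual
          open Reflection W W′ V T maps F (proj₁ ∘ F-spec) (proj₂ ∘ F-spec)
      in möbius-frame W W′ (invert T identity) maps V , λ k →
        let (n′ , eq , n′≡n) = integral-step (proj₁ ∘ bends) (proj₁ ∘ proj₂ ∘ bends) k
        in n′ , eq , ∣-chain n′ (proj₁ (bends k)) (N k) n′≡n (proj₂ (proj₂ (bends k)))

    integerBends-mod-4 : ∀ b → b ∈ integerBends (packing V₀) → ∃ λ k → + 4 ∣ b ℤ.- N k
    integerBends-mod-4 b (S , (W , W∈ , k , S≅Wk) , bS≈b)
      with (n , bW≈n , n≡N) ← proj₂ (family-invariant W∈) k =
      k , ≡.subst (λ z → + 4 ∣ z ℤ.- N k)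
        (fromℤ-injective {n} {b} (trans (sym bW≈n) (trans (sym (≅⇒bend≈ {S} {W k} S≅Wk)) bS≈b))) n≡N

    extension≡N : ∀ k → antipodalExtension (N 0F) (N 1F) (N 2F) (N 3F) (N 0F ℤ.+ N 4F) k ≡ N k
    extension≡N = λ where
        0F → ≡.refl
        1F → ≡.refl
        2F → ≡.refl
        3F → ≡.refl
        4F → high 0F
        5F → high 1F
        6F → high 2F
        7F → high 3F
      where
      high : ∀ c → N 0F ℤ.+ N 4F ℤ.- N (c ↑ˡ 4) ≡ N (4 ↑ʳ c)
      high c = fromℤ-injective (begin
        fromℤ (N 0F ℤ.+ N 4F ℤ.- N (c ↑ˡ 4))
          ≈⟨ trans (fromℤ-+ (N 0F ℤ.+ N 4F) (ℤ.- N (c ↑ˡ 4))) (+-congˡ (fromℤ-neg (N (c ↑ˡ 4)))) ⟩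
        fromℤ (N 0F ℤ.+ N 4F) - fromℤ (N (c ↑ˡ 4))
          ≈⟨ +-cong (fromℤ-sum (N 0F) (N 4F) (bend₀ 0F) (bend₀ 4F)) (-‿cong (bend₀ (c ↑ˡ 4))) ⟨
        totalBend V₀ - bend (V₀ (c ↑ˡ 4))
          ≈⟨ antipodal-bends V₀ frame₀ c ⟨
        bend (V₀ (4 ↑ʳ c))
          ≈⟨ bend₀ (4 ↑ʳ c) ⟩
        fromℤ (N (4 ↑ʳ c)) ∎)

    initial-classified : (∀ k → + 2 ∣ N k) ⊎
      ∃ λ e → ∃ λ i → ∃ λ f → ∃ λ g → ∀ k → + 4 ∣ N (symmetry i f g ⟨$⟩ʳ k) ℤ.- residue (unit e) k
    initial-classified = Sum.map
      (λ h k → ≡.subst (+ 2 ∣_) (extension≡N k) (h k))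
      (λ (e , i , f , g , h) → e , i , f , g , λ k →
        ≡.subst (λ z → + 4 ∣ z ℤ.- residue (unit e) k) (extension≡N (symmetry i f g ⟨$⟩ʳ k)) (h k))
      (proj₂ (classify (N 0F) (N 1F) (N 2F) (N 3F) (N 0F ℤ.+ N 4F)
        (fromℤ-bend-relation V₀ frame₀ N bend₀ (_↑ˡ 4) class-low)))
      where
      class-low : ∀ c → class (c ↑ˡ 4) ≡ c
      class-low = λ { 0F → ≡.refl ; 1F → ≡.refl ; 2F → ≡.refl ; 3F → ≡.refl }

    -- All integer bends of the packing are congruent modulo 4 to some `N k`, so 2 would be a common
    -- divisor and would divide 1.
    primitive⇒not-all-even : IsGCD (integerBends (packing V₀)) (+ 1) → ¬ (∀ k → + 2 ∣ N k)
    primitive⇒not-all-even gcd even = 2∤1 (∣ᵤ⇒∣ (IsGCD.greatest gcd (+ 2) λ b b∈ →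
      let (k , b≡N) = integerBends-mod-4 b b∈ in ∣⇒∣ᵤ (∣-difference {m = b} (∣-trans 2∣4 b≡N) (even k))))
      where
      2∤1 : ¬ (+ 2 ∣ + 1)
      2∤1 = toWitness {a? = ¬? (+ 2 ∣? + 1)} _

  symmetric-admissible : ∀ W → HasFrame W → ∀ i f g → IsAdmissible (W ∘ (symmetry i f g ⟨$⟩ʳ_))
  symmetric-admissible W V i f g k l k≢l =
    (λ ¬same → frame⇒Tangent W V (¬same ∘ proj₁ (symmetry-classes i f g k l))) ,
    (λ same → frame⇒Disjoint W V (λ πk≡πl → k≢l (π-injective πk≡πl)) (proj₂ (symmetry-classes i f g k l) same))
    where
    π = symmetry i f g
    π-injective : ∀ {k l} → π ⟨$⟩ʳ k ≡ π ⟨$⟩ʳ l → k ≡ l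
    π-injective eq = ≡.trans (≡.sym (inverseˡ π)) (≡.trans (≡.cong (π ⟨$⟩ˡ_) eq) (inverseˡ π))

-- The residues of a primitive packing

open import Data.Integer.Base using (-_; 0ℤ; 1ℤ; -1ℤ)

proposition5p1 : (ℛ : CompleteOrderedField) →
    let open Geometry ℛ
        open CompleteOrderedField ℛ using (_≈_) in
    (V₀ : Configuration) → IsOrthoplicial V₀ → IsPrimitive (packing V₀) →
    ∃ λ (ε : ℤ) → (ε ≡ 1ℤ ⊎ ε ≡ -1ℤ) ×
      (∀ (b : ℤ) → b ∈ integerBends (packing V₀) → ¬ (b ≡ - ε [mod + 4 ])) ×
      (∀ (V : Configuration) → V ∈ Family V₀ →
        ∃ λ (π : Permutation′ 8) → IsAdmissible (V ∘ (π ⟨$⟩ʳ_)) ×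
          (∀ k → ∃ λ (b : ℤ) → bend (V (π ⟨$⟩ʳ k)) ≈ fromℤ b ×
            b ≡ lookup (0ℤ ∷ 0ℤ ∷ ε ∷ ε ∷ + 2 ∷ + 2 ∷ ε ∷ ε ∷ []) k [mod + 4 ]))
proposition5p1 ℛ V₀ orthoplicial (integral , gcd) = conclude (initial-classified V₀ frame₀ N bend₀)
  where
  open Geometry ℛ
  open CompleteOrderedField ℛ using (_≈_; refl)
  open Packings ℛ

  frame₀ : HasFrame V₀
  frame₀ = orthoplicial-frame V₀ orthoplicial

  integral₀ : ∀ k → ∃ λ n → bend (V₀ k) ≈ fromℤ n
  integral₀ k = integral (bend (V₀ k))
    (V₀ k , (V₀ , initial , k , (id , id) , (id , id)) , refl)

  N : Fin 8 → ℤ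
  N k = proj₁ (integral₀ k)

  bend₀ : ∀ k → bend (V₀ k) ≈ fromℤ (N k)
  bend₀ k = proj₂ (integral₀ k)

  -- `residue ε` unfolds to the list in the theorem, so this is the conclusion up to computation, in
  -- the form in which the arithmetic lemmas apply.
  Goal : Set
  Goal = ∃ λ (ε : ℤ) → (ε ≡ 1ℤ ⊎ ε ≡ -1ℤ) ×
    (∀ (b : ℤ) → b ∈ integerBends (packing V₀) → ¬ (b ≡ - ε [mod + 4 ])) ×
    (∀ (V : Configuration) → V ∈ Family V₀ →
      ∃ λ (π : Permutation′ 8) → IsAdmissible (V ∘ (π ⟨$⟩ʳ_)) ×
        (∀ k → ∃ λ (b : ℤ) → bend (V (π ⟨$⟩ʳ k)) ≈ fromℤ b × b ≡ residue ε k [mod + 4 ]))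

  conclude : (∀ k → + 2 ∣ N k) ⊎
    (∃ λ e → ∃ λ i → ∃ λ f → ∃ λ g → ∀ k → + 4 ∣ N (symmetry i f g ⟨$⟩ʳ k) ℤ.- residue (unit e) k) → Goal
  conclude (inj₁ even) = contradiction even (primitive⇒not-all-even V₀ frame₀ N bend₀ gcd)
  conclude (inj₂ (e , i , f , g , N≡residue)) = unit e , unit-±1 e , obstruction , configurations
    where
    π : Permutation′ 8
    π = symmetry i f g

    N≡residue∘π⁻¹ : ∀ k → + 4 ∣ N k ℤ.- residue (unit e) (π ⟨$⟩ˡ k)
    N≡residue∘π⁻¹ k = ≡.subst (λ l → + 4 ∣ N l ℤ.- residue (unit e) (π ⟨$⟩ˡ k)) (inverseʳ π)
      (N≡residue (π ⟨$⟩ˡ k))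

    -- If b were -ε, the chain from the residue at position l through `N k` and b to -ε would
    -- contradict `residue≢-unit`.
    obstruction-at : ∀ b k → + 4 ∣ b ℤ.- N k → ¬ (b ≡ - unit e [mod + 4 ])
    obstruction-at b k b≡N b≡-ε = residue≢-unit e l (∣-chain (residue (unit e) l) b (- unit e)
        (∣-sym b (residue (unit e) l) (∣-chain b (N k) (residue (unit e) l) b≡N (N≡residue∘π⁻¹ k)))
        (∣ᵤ⇒∣ b≡-ε))
      where
      l : Fin 8
      l = π ⟨$⟩ˡ k

    obstruction : ∀ b → b ∈ integerBends (packing V₀) → ¬ (b ≡ - unit e [mod + 4 ])
    obstruction b b∈ = obstruction-at b (proj₁ near) (proj₂ near)
      where
      near : ∃ λ k → + 4 ∣ b ℤ.- N k
      near = integerBends-mod-4 V₀ frame₀ N bend₀ b b∈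

    bend-residue : ∀ V → (∀ k → ∃ λ n → bend (V k) ≈ fromℤ n × + 4 ∣ n ℤ.- N k) →
      ∀ k → ∃ λ b → bend (V (π ⟨$⟩ʳ k)) ≈ fromℤ b × b ≡ residue (unit e) k [mod + 4 ]
    bend-residue V bends k = b , proj₁ (proj₂ (bends (π ⟨$⟩ʳ k))) ,
      ∣⇒∣ᵤ (∣-chain b (N (π ⟨$⟩ʳ k)) (residue (unit e) k) (proj₂ (proj₂ (bends (π ⟨$⟩ʳ k)))) (N≡residue k))
      where
      b : ℤ
      b = proj₁ (bends (π ⟨$⟩ʳ k))

    configurations : ∀ V → V ∈ Family V₀ → ∃ λ π → IsAdmissible (V ∘ (π ⟨$⟩ʳ_)) ×
      (∀ k → ∃ λ b → bend (V (π ⟨$⟩ʳ k)) ≈ fromℤ b × b ≡ residue (unit e) k [mod + 4 ])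
    configurations V V∈ = π , symmetric-admissible V (proj₁ invariant) i f g , bend-residue V (proj₂ invariant)
      where
      invariant : HasFrame V × (∀ k → ∃ λ n → bend (V k) ≈ fromℤ n × + 4 ∣ n ℤ.- N k)
      invariant = family-invariant V₀ frame₀ N bend₀ V∈
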